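{- For every prime power $q>7$, $$M(q+1,q-4)\ \ge\ \mathcal{T}_3(q)+\max\{N^m_{3,2}(q),\,N_{3,0}(q)\}.$$
   Context: For permutations $\pi,\sigma$ of the same $n$ symbols, the Hamming distance $hd(\pi,\sigma)$ is the number of positions $x$ with $\pi(x)\ne\sigma(x)$. $M(n,D)$ is the maximum size of a set of permutations on $n$ symbols in which any two distinct permutations have Hamming distance at least $D$. Let $q$ be a prime power, $\mathbb{F}_q$ the field with $q$ elements and $\mathcal{P}^1(\mathbb{F}_q)=\mathbb{F}_q\cup\{\infty\}$. Let $V,U$ be nonzero polynomials over $\mathbb{F}_q$ with $\gcd(V,U)=1$, of degrees $v,u$ and leading coefficients $a_v,b_u$. The rational function $V(x)/U(x)$ is evaluated on $\mathcal{P}^1(\mathbb{F}_q)$ as follows: at $a\in\mathbb{F}_q$ its value is $V(a)/U(a)$, understood as $\infty$ if $U(a)=0$; at $\infty$ its value is $\infty$ if $v>u$, $0$ if $v<u$, and $a_v/b_v$ if $v=u$. It is a permutation rational function (PRF) if it permutes $\mathcal{P}^1(\mathbb{F}_q)$. $P_{v,u}(q)$ is the set of PRFs $V(x)/U(x)$ (as rational functions, so $V/U$ and $(cV)/(cU)$ with $c\in\mathbb{F}_q\setminus\{0\}$ are the same element) with $\deg V=v$ and $\deg U=u$, and $N_{v,u}(q)=|P_{v,u}(q)|$. $N^m_{v,u}(q)$ is the number of PRFs $V(x)/U(x)$ in $P_{v,u}(q)$ with both $V$ and $U$ monic. $\mathcal{T}_3(q)=\sum N_{v,u}(q)$, the sum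 being over all pairs $(v,u)$ with $0\le v,u\le 2$. -}

module Defs where

open import Algebra.Bundles using (RawSemiring; CommutativeRing)
open import Algebra.Structures using (IsCommutativeRing)
import Algebra.Definitions.RawMagma as RawMagmaDefinitions
import Algebra.Definitions.RawSemiring as RawSemiringDefinitions
open import Data.Empty using (⊥-elim)
open import Data.Fin as Fin using (Fin; zero; suc; finToFun; funToFin; punchIn)
import Data.Fin.Properties as Fin
open import Data.Fin.Permutation as Perm
  using (Permutation′; _⟨$⟩ʳ_; insert; remove; insert-punchIn; insert-remove)
open import Data.List as List
  using (List; []; _∷_; length; filter; deduplicate; allFin; upTo; cartesianProduct; cartesianProductWith)
open import Data.List.Properties using (filter-≐)
open import Data.Nat.ListAction using (sum)
open import Data.List.Membership.Propositional using (_∈_)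
open import Data.List.Membership.Propositional.Properties
  using (∈-allFin; ∈-map⁺; ∈-cartesianProductWith⁺)
import Data.List.Relation.Unary.All as All
open import Data.List.Relation.Unary.Any as Any using (Any; here; there)
import Data.List.Relation.Unary.Any.Properties as Any
open import Data.Maybe using (Maybe; just; nothing)
import Data.Maybe.Properties as Maybe
open import Data.Nat as ℕ using (ℕ; zero; suc; _≤_; _<_; z≤n; s≤s)
import Data.Nat.Properties as ℕ
open import Data.Nat.Primality using (Prime)
open import Data.Product using (∃; ∃-syntax; _×_; _,_; proj₁; proj₂)
open import Data.Sum using (_⊎_; inj₁; inj₂)
open import Data.Vec as Vec using (Vec; []; _∷_; last; toList)
open import Function using (_∘_; _↔_; Inverse)
open import Function.Definitions using (Injective; Surjective; Bijective)
open import Function.Properties.Inverse using (↔⇒↣)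
open import Level using (0ℓ)
open import Relation.Binary using (Rel; DecidableEquality; tri<; tri≈; tri>)
open import Relation.Binary.PropositionalEquality
  using (_≡_; _≢_; refl; sym; trans; cong; cong₂; subst; module ≡-Reasoning)
open import Relation.Nullary using (Dec; yes; no; ¬_; ¬?; _×-dec_; _→-dec_)
open import Relation.Nullary.Decidable using (map′; via-injection)
open import Relation.Unary using (Pred; Decidable)

module _ {n : ℕ} where

  hd : Permutation′ n → Permutation′ n → ℕ
  hd π σ = length (filter (λ x → ¬? (π ⟨$⟩ʳ x Fin.≟ σ ⟨$⟩ʳ x)) (allFin n))

  _≈?_ : (π σ : Permutation′ n) → Dec (π Perm.≈ σ)
  π ≈? σ = Fin.all? (λ x → π ⟨$⟩ʳ x Fin.≟ σ ⟨$⟩ʳ x)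

  hd-cong : ∀ (π π′ σ σ′ : Permutation′ n) → π Perm.≈ π′ → σ Perm.≈ σ′ → hd π σ ≡ hd π′ σ′
  hd-cong π π′ σ σ′ π≈π′ σ≈σ′ = cong length (filter-≐ _ _
    ( (λ {x} ne eq → ne (trans (π≈π′ x) (trans eq (sym (σ≈σ′ x)))))
    , (λ {x} ne eq → ne (trans (sym (π≈π′ x)) (trans eq (σ≈σ′ x)))) )
    (allFin n))

-- A set of k permutations, listed without repetition (this matters when D = 0),
-- with all pairwise Hamming distances at least D.
record PermutationArray (n D k : ℕ) : Set where
  field
    π        : Fin k → Permutation′ n
    distinct : ∀ i j → i ≢ j → ¬ (π i Perm.≈ π j)
    distance : ∀ i j → i ≢ j → D ≤ hd (π i) (π j)

perms : ∀ n → List (Permutation′ n)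
perms zero    = Perm.id ∷ []
perms (suc n) = cartesianProductWith (insert zero) (allFin (suc n)) (perms n)

perms-complete : ∀ {n} (π : Permutation′ n) → Any (π Perm.≈_) (perms n)
perms-complete {zero}  π = here λ ()
perms-complete {suc n} π =
  Any.cartesianProductWith⁺ (insert zero) step (∈-allFin (π ⟨$⟩ʳ zero))
    (perms-complete (remove zero π))
  where
  step : ∀ {j σ} → π ⟨$⟩ʳ zero ≡ j → remove zero π Perm.≈ σ → π Perm.≈ insert zero j σ
  step refl eq zero    = refl
  step {σ = σ} refl eq (suc k) = begin
    π ⟨$⟩ʳ suc k                                       ≡⟨ insert-remove zero π (suc k) ⟨
    insert zero j (remove zero π) ⟨$⟩ʳ suc k           ≡⟨ insert-punchIn zero j (remove zero π) k ⟩
    punchIn j (remove zero π ⟨$⟩ʳ k)                   ≡⟨ cong (punchIn j) (eq k) ⟩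
    punchIn j (σ ⟨$⟩ʳ k)                               ≡⟨ insert-punchIn zero j σ k ⟨
    insert zero j σ ⟨$⟩ʳ suc k                         ∎
    where
    open ≡-Reasoning
    j = π ⟨$⟩ʳ zero

module _ {n : ℕ} where

  private
    perm : Fin (length (perms n)) → Permutation′ n
    perm = List.lookup (perms n)

    code : Permutation′ n → Fin (length (perms n))
    code π = Any.index (perms-complete π)

    perm-code : ∀ π → π Perm.≈ perm (code π)
    perm-code π = Any.lookup-index (perms-complete π)

  array-size : ∀ {D k} → PermutationArray n D k → k ≤ length (perms n)
  array-size {k = k} A = Fin.injective⇒≤ code∘π-injective
    where
    open PermutationArray A
    code∘π-injective : Injective _≡_ _≡_ (code ∘ π)
    code∘π-injective {i} {j} eq with i Fin.≟ j
    ... | yes i≡j = i≡j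
    ... | no  i≢j = ⊥-elim (distinct i j i≢j λ x →
      trans (perm-code (π i) x)
        (trans (cong (λ c → perm c ⟨$⟩ʳ x) eq) (sym (perm-code (π j) x))))

  array? : ∀ D → Decidable (PermutationArray n D)
  array? D k = map′ build unbuild
    (Fin.any? {n = length (perms n) ℕ.^ k} λ c →
      Fin.all? λ i → Fin.all? λ j →
        ¬? (i Fin.≟ j) →-dec
        (¬? (family c i ≈? family c j) ×-dec (D ℕ.≤? hd (family c i) (family c j))))
    where
    family : Fin (length (perms n) ℕ.^ k) → Fin k → Permutation′ n
    family c = perm ∘ finToFun c

    Good : Fin (length (perms n) ℕ.^ k) → Set
    Good c = ∀ i j → i ≢ j →
      ¬ (family c i Perm.≈ family c j) × D ≤ hd (family c i) (family c j)

    build : ∃ Good → PermutationArray n D k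
    build (c , good) = record
      { π        = family c
      ; distinct = λ i j i≢j → proj₁ (good i j i≢j)
      ; distance = λ i j i≢j → proj₂ (good i j i≢j)
      }

    unbuild : PermutationArray n D k → ∃ Good
    unbuild A = c , λ i j i≢j →
        (λ eq → distinct i j i≢j λ x → trans (π≈ i x) (trans (eq x) (sym (π≈ j x))))
      , subst (D ≤_) (hd-cong (π i) (family c i) (π j) (family c j) (π≈ i) (π≈ j)) (distance i j i≢j)
      where
      open PermutationArray A
      c = funToFin (code ∘ π)
      π≈ : ∀ i → π i Perm.≈ family c i
      π≈ i x = trans (perm-code (π i) x)
        (cong (λ d → perm d ⟨$⟩ʳ x) (sym (Fin.finToFun-funToFin (code ∘ π) i)))

-- The largest k ≤ b satisfying P, provided P 0 holds.
greatest : ∀ {P : Pred ℕ 0ℓ} → Decidable P → ℕ → ℕ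
greatest P? zero    = zero
greatest P? (suc b) with P? (suc b)
... | yes _ = suc b
... | no  _ = greatest P? b

greatest-satisfies : ∀ {P : Pred ℕ 0ℓ} (P? : Decidable P) b → P 0 → P (greatest P? b)
greatest-satisfies P? zero    p0 = p0
greatest-satisfies P? (suc b) p0 with P? (suc b)
... | yes p = p
... | no  _ = greatest-satisfies P? b p0

greatest-upper : ∀ {P : Pred ℕ 0ℓ} (P? : Decidable P) b {k} → k ≤ b → P k → k ≤ greatest P? b
greatest-upper P? zero    k≤b _ = k≤b
greatest-upper {P} P? (suc b) k≤b p with P? (suc b)
... | yes _ = k≤b
... | no ¬p with ℕ.m≤n⇒m<n∨m≡n k≤b
...   | inj₁ (s≤s k≤b′) = greatest-upper P? b k≤b′ p
...   | inj₂ refl       = ⊥-elim (¬p p)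

-- The search bound length (perms n) = n! is never exceeded (array-size), so this is
-- the true maximum: see M-attained and M-upper.
M : ℕ → ℕ → ℕ
M n D = greatest (array? {n} D) (length (perms n))

M-attained : ∀ n D → PermutationArray n D (M n D)
M-attained n D = greatest-satisfies (array? D) (length (perms n))
  record { π = λ () ; distinct = λ () ; distance = λ () }

M-upper : ∀ {n D k} → PermutationArray n D k → k ≤ M n D
M-upper {n} {D} A = greatest-upper (array? D) (length (perms n)) (array-size A) A

IsPrimePower : ℕ → Set
IsPrimePower q = ∃[ p ] ∃[ k ] Prime p × q ≡ p ℕ.^ suc k

-- The value of 0# ⁻¹ is left unconstrained; it plays no role in the value of a PRF.
record FiniteField (q : ℕ) : Set₁ where
  infixl 6 _+_
  infixl 7 _*_
  infix  8 -_
  infix  9 _⁻¹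
  field
    Carrier           : Set
    _+_ _*_           : Carrier → Carrier → Carrier
    -_ _⁻¹            : Carrier → Carrier
    0# 1#             : Carrier
    isCommutativeRing : IsCommutativeRing _≡_ _+_ _*_ -_ 0# 1#
    0#≢1#             : 0# ≢ 1#
    *-inverseʳ        : ∀ x → x ≢ 0# → x * x ⁻¹ ≡ 1#
    enumeration       : Carrier ↔ Fin q

  commutativeRing : CommutativeRing 0ℓ 0ℓ
  commutativeRing = record { isCommutativeRing = isCommutativeRing }

  open IsCommutativeRing isCommutativeRing public
    using (+-identityˡ; +-identityʳ; *-identityˡ; *-assoc; *-comm; zeroˡ; zeroʳ)

  infix 4 _≟_
  _≟_ : DecidableEquality Carrier
  _≟_ = via-injection (↔⇒↣ enumeration) Fin._≟_

  elements : List Carrier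
  elements = List.map (Inverse.from enumeration) (allFin q)

  elements-complete : ∀ x → x ∈ elements
  elements-complete x =
    subst (_∈ elements) (Inverse.strictlyInverseʳ enumeration x)
      (∈-map⁺ _ (∈-allFin (Inverse.to enumeration x)))

module Search {A : Set} (xs : List A) (complete : ∀ x → x ∈ xs) {P : Pred A 0ℓ} (P? : Decidable P) where

  any? : Dec (∃ P)
  any? = map′ Any.satisfied
    (λ (x , px) → Any.map (λ eq → subst P eq px) (complete x)) (Any.any? P? xs)

  all? : Dec (∀ x → P x)
  all? = map′ (λ all x → All.lookup all (complete x)) (λ f → All.tabulate λ {x} _ → f x) (All.all? P? xs)

module _ {q : ℕ} (F : FiniteField q) where

  open FiniteField F

  -- Coefficients in order of increasing degree; trailing zeros are allowed.
  Poly : Set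
  Poly = List Carrier

  coeff : Poly → ℕ → Carrier
  coeff []      _       = 0#
  coeff (a ∷ p) zero    = a
  coeff (a ∷ p) (suc i) = coeff p i

  infix 4 _≈ᴾ_
  _≈ᴾ_ : Rel Poly 0ℓ
  p ≈ᴾ r = ∀ i → coeff p i ≡ coeff r i

  infixl 6 _+ᴾ_
  _+ᴾ_ : Poly → Poly → Poly
  []      +ᴾ r       = r
  (a ∷ p) +ᴾ []      = a ∷ p
  (a ∷ p) +ᴾ (b ∷ r) = a + b ∷ p +ᴾ r

  infixl 7 _*ᴾ_
  _*ᴾ_ : Poly → Poly → Poly
  []      *ᴾ r = []
  (a ∷ p) *ᴾ r = List.map (a *_) r +ᴾ (0# ∷ p *ᴾ r)

  1ᴾ : Poly
  1ᴾ = 1# ∷ []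

  polynomials : RawSemiring 0ℓ 0ℓ
  polynomials = record
    { _≈_ = _≈ᴾ_ ; _+_ = _+ᴾ_ ; _*_ = _*ᴾ_ ; 0# = [] ; 1# = 1ᴾ }

  open RawSemiringDefinitions polynomials using (_∣_; Coprime)
  open RawMagmaDefinitions (RawSemiring.*-rawMagma polynomials) using (_,_)

  eval : Poly → Carrier → Carrier
  eval p x = List.foldr (λ c r → c + x * r) 0# p

  infix 4 _≈ᴾ?_
  _≈ᴾ?_ : ∀ p r → Dec (p ≈ᴾ r)
  []      ≈ᴾ? []      = yes λ _ → refl
  []      ≈ᴾ? (b ∷ r) = map′ (λ { (e , es) zero → e ; (e , es) (suc i) → es i })
                             (λ es → es 0 , es ∘ suc) (0# ≟ b ×-dec [] ≈ᴾ? r)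
  (a ∷ p) ≈ᴾ? []      = map′ (λ { (e , es) zero → e ; (e , es) (suc i) → es i })
                             (λ es → es 0 , es ∘ suc) (a ≟ 0# ×-dec p ≈ᴾ? [])
  (a ∷ p) ≈ᴾ? (b ∷ r) = map′ (λ { (e , es) zero → e ; (e , es) (suc i) → es i })
                             (λ es → es 0 , es ∘ suc) (a ≟ b ×-dec p ≈ᴾ? r)

  coeff-+ : ∀ p r i → coeff (p +ᴾ r) i ≡ coeff p i + coeff r i
  coeff-+ []      r       i       = sym (+-identityˡ _)
  coeff-+ (a ∷ p) []      i       = sym (+-identityʳ _)
  coeff-+ (a ∷ p) (b ∷ r) zero    = refl
  coeff-+ (a ∷ p) (b ∷ r) (suc i) = coeff-+ p r i

  coeff-scale : ∀ a r i → coeff (List.map (a *_) r) i ≡ a * coeff r i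
  coeff-scale a []      i       = sym (zeroʳ a)
  coeff-scale a (b ∷ r) zero    = refl
  coeff-scale a (b ∷ r) (suc i) = coeff-scale a r i

  coeff-∷* : ∀ a p r i → coeff ((a ∷ p) *ᴾ r) i ≡ a * coeff r i + coeff (0# ∷ p *ᴾ r) i
  coeff-∷* a p r i =
    trans (coeff-+ (List.map (a *_) r) _ i) (cong (_+ coeff (0# ∷ p *ᴾ r) i) (coeff-scale a r i))

  0*-≈ : ∀ p r → p ≈ᴾ [] → p *ᴾ r ≈ᴾ []
  0*-≈ []      r e i = refl
  0*-≈ (a ∷ p) r e i = trans (coeff-∷* a p r i)
    (trans (cong₂ _+_ (trans (cong (_* coeff r i) (e 0)) (zeroˡ _)) (tail i)) (+-identityˡ _))
    where
    tail : ∀ i → coeff (0# ∷ p *ᴾ r) i ≡ 0#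
    tail zero    = refl
    tail (suc i) = 0*-≈ p r (e ∘ suc) i

  *-congˡ : ∀ p r s → r ≈ᴾ s → p *ᴾ r ≈ᴾ p *ᴾ s
  *-congˡ []      r s e i = refl
  *-congˡ (a ∷ p) r s e i = trans (coeff-∷* a p r i)
    (trans (cong₂ _+_ (cong (a *_) (e i)) (tail i)) (sym (coeff-∷* a p s i)))
    where
    tail : ∀ i → coeff (0# ∷ p *ᴾ r) i ≡ coeff (0# ∷ p *ᴾ s) i
    tail zero    = refl
    tail (suc i) = *-congˡ p r s e i

  *-congʳ : ∀ p r s → p ≈ᴾ r → p *ᴾ s ≈ᴾ r *ᴾ s
  *-congʳ []      r       s e i = sym (0*-≈ r s (sym ∘ e) i)
  *-congʳ (a ∷ p) []      s e i = 0*-≈ (a ∷ p) s e i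
  *-congʳ (a ∷ p) (b ∷ r) s e i = trans (coeff-∷* a p s i)
    (trans (cong₂ _+_ (cong (_* coeff s i) (e 0)) (tail i)) (sym (coeff-∷* b r s i)))
    where
    tail : ∀ i → coeff (0# ∷ p *ᴾ s) i ≡ coeff (0# ∷ r *ᴾ s) i
    tail zero    = refl
    tail (suc i) = *-congʳ p r s (e ∘ suc) i

  -- Coprimality is decidable: divisors and cofactors of a polynomial of
  -- degree d can be searched among coefficient vectors of length d + 1.

  VanishesAbove : Poly → ℕ → Set
  VanishesAbove p d = ∀ i → d < i → coeff p i ≡ 0#

  HasDegree : Poly → ℕ → Set
  HasDegree p d = coeff p d ≢ 0# × VanishesAbove p d

  zero-or-degree : ∀ p → p ≈ᴾ [] ⊎ ∃ (HasDegree p)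
  zero-or-degree []      = inj₁ λ _ → refl
  zero-or-degree (a ∷ p) with zero-or-degree p
  ... | inj₂ (d , lead , above) = inj₂ (suc d , lead , λ { (suc i) (s≤s d<i) → above i d<i })
  ... | inj₁ p≈0 with a ≟ 0#
  ...   | yes a≡0 = inj₁ λ { zero → a≡0 ; (suc i) → p≈0 i }
  ...   | no  a≢0 = inj₂ (0 , a≢0 , λ { (suc i) _ → p≈0 i })

  *-nonzero : ∀ {a b} → a ≢ 0# → b ≢ 0# → a * b ≢ 0#
  *-nonzero {a} {b} a≢0 b≢0 ab≡0 = b≢0 (begin
    b               ≡⟨ *-identityˡ b ⟨
    1# * b          ≡⟨ cong (_* b) (trans (*-comm (a ⁻¹) a) (*-inverseʳ a a≢0)) ⟨
    a ⁻¹ * a * b    ≡⟨ *-assoc (a ⁻¹) a b ⟩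
    a ⁻¹ * (a * b)  ≡⟨ cong (a ⁻¹ *_) ab≡0 ⟩
    a ⁻¹ * 0#       ≡⟨ zeroʳ (a ⁻¹) ⟩
    0#              ∎)
    where open ≡-Reasoning

  top-coeff : ∀ p r d e → VanishesAbove p d → VanishesAbove r e →
              coeff (p *ᴾ r) (d ℕ.+ e) ≡ coeff p d * coeff r e
  top-coeff []      r d       e pv rv = sym (zeroˡ _)
  top-coeff (a ∷ p) r zero    e pv rv = trans (coeff-∷* a p r e)
    (trans (cong (a * coeff r e +_) (tail e)) (+-identityʳ _))
    where
    tail : ∀ i → coeff (0# ∷ p *ᴾ r) i ≡ 0#
    tail zero    = refl
    tail (suc i) = 0*-≈ p r (λ i → pv (suc i) (s≤s z≤n)) i
  top-coeff (a ∷ p) r (suc d) e pv rv = trans (coeff-∷* a p r (suc (d ℕ.+ e)))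
    (trans (cong₂ _+_
      (trans (cong (a *_) (rv _ (s≤s (ℕ.m≤n+m e d)))) (zeroʳ a))
      (top-coeff p r d e (λ i d<i → pv (suc i) (s≤s d<i)) rv))
    (+-identityˡ _))

  factors-vanish : ∀ p r s d → HasDegree s d → p *ᴾ r ≈ᴾ s →
                   VanishesAbove p d × VanishesAbove r d
  factors-vanish p r s d (lead , above) eq with zero-or-degree p | zero-or-degree r
  ... | inj₁ p≈0 | _        = ⊥-elim (lead (trans (sym (eq d)) (0*-≈ p r p≈0 d)))
  ... | inj₂ _   | inj₁ r≈0 =
    ⊥-elim (lead (trans (sym (eq d)) (trans (*-congˡ p r [] r≈0 d) (p*0 p d))))
    where
    p*0 : ∀ p i → coeff (p *ᴾ []) i ≡ 0#
    p*0 []      i       = refl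
    p*0 (a ∷ p) zero    = refl
    p*0 (a ∷ p) (suc i) = p*0 p i
  ... | inj₂ (m , pm , pv) | inj₂ (n , rn , rv) =
      (λ i d<i → pv i (ℕ.≤-<-trans (ℕ.≤-trans (ℕ.m≤m+n m n) m+n≤d) d<i))
    , (λ i d<i → rv i (ℕ.≤-<-trans (ℕ.≤-trans (ℕ.m≤n+m n m) m+n≤d) d<i))
    where
    m+n≤d : m ℕ.+ n ≤ d
    m+n≤d = ℕ.≮⇒≥ λ d<m+n → *-nonzero pm rn
      (trans (sym (top-coeff p r m n pv rv)) (trans (eq (m ℕ.+ n)) (above _ d<m+n)))

  truncate : ∀ n → Poly → Vec Carrier n
  truncate zero    p       = []
  truncate (suc n) []      = 0# ∷ truncate n []
  truncate (suc n) (a ∷ p) = a ∷ truncate n p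

  truncate-≈ : ∀ n p → (∀ i → n ≤ i → coeff p i ≡ 0#) → toList (truncate n p) ≈ᴾ p
  truncate-≈ zero    p       v i       = sym (v i z≤n)
  truncate-≈ (suc n) []      v zero    = refl
  truncate-≈ (suc n) []      v (suc i) = truncate-≈ n [] (λ _ _ → refl) i
  truncate-≈ (suc n) (a ∷ p) v zero    = refl
  truncate-≈ (suc n) (a ∷ p) v (suc i) = truncate-≈ n p (λ j n≤j → v (suc j) (s≤s n≤j)) i

  vectors : ∀ n → List (Vec Carrier n)
  vectors zero    = [] ∷ []
  vectors (suc n) = cartesianProductWith _∷_ elements (vectors n)

  vectors-complete : ∀ {n} (xs : Vec Carrier n) → xs ∈ vectors n
  vectors-complete []       = here refl
  vectors-complete (x ∷ xs) =
    ∈-cartesianProductWith⁺ _∷_ (elements-complete x) (vectors-complete xs)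

  ∣-respˡ : ∀ p r {s} → p ≈ᴾ r → p ∣ s → r ∣ s
  ∣-respˡ p r p≈r (t , eq) = t , λ i → trans (*-congˡ t r p (sym ∘ p≈r) i) (eq i)

  ∣? : ∀ p {s d} → HasDegree s d → Dec (p ∣ s)
  ∣? p {s} {d} deg = map′ (λ (t , eq) → toList t , eq) short
    (Search.any? (vectors (suc d)) vectors-complete λ t → toList t *ᴾ p ≈ᴾ? s)
    where
    short : p ∣ s → ∃ λ (t : Vec Carrier (suc d)) → toList t *ᴾ p ≈ᴾ s
    short (t , eq) = truncate (suc d) t , λ i →
      trans (*-congʳ (toList (truncate (suc d) t)) t p (truncate-≈ (suc d) t (proj₁ (factors-vanish t p s d deg eq))) i) (eq i)

  coprime? : ∀ {r s d e} → HasDegree r d → HasDegree s e → Dec (Coprime r s)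
  coprime? {r} {s} {d} degr degs = map′ general (λ co z → co {toList z})
    (Search.all? (vectors (suc d)) vectors-complete λ z →
      ∣? (toList z) degr →-dec (∣? (toList z) degs →-dec ∣? (toList z) degree-1))
    where
    degree-1 : HasDegree 1ᴾ 0
    degree-1 = 0#≢1# ∘ sym , λ { (suc i) _ → refl }

    general : (∀ (z : Vec Carrier (suc d)) → toList z ∣ r → toList z ∣ s → toList z ∣ 1ᴾ) →
              Coprime r s
    general co {z} z∣r@(t , eq) z∣s =
      ∣-respˡ (toList z′) z z′≈z
        (co z′ (∣-respˡ z (toList z′) (sym ∘ z′≈z) z∣r) (∣-respˡ z (toList z′) (sym ∘ z′≈z) z∣s))
      where
      z′ = truncate (suc d) z
      z′≈z = truncate-≈ (suc d) z (proj₂ (factors-vanish t z r d degr eq))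

  last-degree : ∀ {n} (p : Vec Carrier (suc n)) → last p ≢ 0# → HasDegree (toList p) n
  last-degree (a ∷ [])     a≢0 = a≢0 , λ { (suc i) _ → refl }
  last-degree (a ∷ b ∷ p)  l≢0 with last-degree (b ∷ p) l≢0
  ... | lead , above = lead , λ { (suc i) (s≤s n<i) → above i n<i }

  -- nothing is the point ∞.
  P¹ : Set
  P¹ = Maybe Carrier

  points : List P¹
  points = nothing ∷ List.map just elements

  points-complete : ∀ x → x ∈ points
  points-complete nothing  = here refl
  points-complete (just a) = there (∈-map⁺ just (elements-complete a))

  -- V/U with V of degree ≤ v and U of degree ≤ u; IsPRF below makes the degrees exact.
  Fraction : ℕ → ℕ → Set
  Fraction v u = Vec Carrier (suc v) × Vec Carrier (suc u)

  value : ∀ {v u} → Fraction v u → P¹ → P¹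
  value (V , U) (just a) with eval (toList U) a ≟ 0#
  ... | yes _ = nothing
  ... | no  _ = just (eval (toList V) a * eval (toList U) a ⁻¹)
  value {v} {u} (V , U) nothing with ℕ.<-cmp v u
  ... | tri< _ _ _ = just 0#
  ... | tri≈ _ _ _ = just (last V * last U ⁻¹)
  ... | tri> _ _ _ = nothing

  -- Equality in the field of rational functions.
  _≃_ : ∀ {v u} → Rel (Fraction v u) 0ℓ
  (V , U) ≃ (V′ , U′) = toList V *ᴾ toList U′ ≈ᴾ toList V′ *ᴾ toList U

  _≃?_ : ∀ {v u} (f g : Fraction v u) → Dec (f ≃ g)
  (V , U) ≃? (V′ , U′) = toList V *ᴾ toList U′ ≈ᴾ? toList V′ *ᴾ toList U

  record IsPRF {v u} (f : Fraction v u) : Set where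
    V = proj₁ f
    U = proj₂ f
    field
      V-degree : last V ≢ 0#
      U-degree : last U ≢ 0#
      coprime  : Coprime (toList V) (toList U)
      permutes : Bijective _≡_ _≡_ (value f)

  IsMonic : ∀ {v u} → Fraction v u → Set
  IsMonic (V , U) = last V ≡ 1# × last U ≡ 1#

  isMonic? : ∀ {v u} → Decidable (IsMonic {v} {u})
  isMonic? (V , U) = last V ≟ 1# ×-dec last U ≟ 1#

  bijective? : (f : P¹ → P¹) → Dec (Bijective _≡_ _≡_ f)
  bijective? f = injective? ×-dec surjective?
    where
    open module Points {P : Pred P¹ 0ℓ} = Search points points-complete {P}

    _≟¹_ : DecidableEquality P¹
    _≟¹_ = Maybe.≡-dec _≟_

    injective? : Dec (Injective _≡_ _≡_ f)
    injective? = map′ (λ inj {x} {y} → inj x y) (λ inj x y → inj {x} {y})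
      (all? λ x → all? λ y → f x ≟¹ f y →-dec x ≟¹ y)

    surjective? : Dec (Surjective _≡_ _≡_ f)
    surjective? = map′
      (λ sur y → proj₁ (sur y) , λ { refl → proj₂ (sur y) })
      (λ sur y → proj₁ (sur y) , proj₂ (sur y) refl)
      (all? λ y → any? λ x → f x ≟¹ y)

  isPRF? : ∀ {v u} → Decidable (IsPRF {v} {u})
  isPRF? f@(V , U) with last V ≟ 0# | last U ≟ 0#
  ... | yes V≡0 | _       = no λ prf → IsPRF.V-degree prf V≡0
  ... | no _    | yes U≡0 = no λ prf → IsPRF.U-degree prf U≡0
  ... | no V≢0  | no U≢0
    with coprime? (last-degree V V≢0) (last-degree U U≢0) | bijective? (value f)
  ...   | no ¬co | _       = no λ prf → ¬co (IsPRF.coprime prf)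
  ...   | yes _  | no ¬bij = no λ prf → ¬bij (IsPRF.permutes prf)
  ...   | yes co | yes bij =
    yes record { V-degree = V≢0 ; U-degree = U≢0 ; coprime = co ; permutes = bij }

  fractions : ∀ v u → List (Fraction v u)
  fractions v u = cartesianProduct (vectors (suc v)) (vectors (suc u))

  -- The elements of P_{v,u}(q), one representative V/U for each rational function.
  PRFs : ∀ v u → List (Fraction v u)
  PRFs v u = deduplicate _≃?_ (filter isPRF? (fractions v u))

  monicPRFs : ∀ v u → List (Fraction v u)
  monicPRFs v u = deduplicate _≃?_ (filter (λ f → isPRF? f ×-dec isMonic? f) (fractions v u))

  N : ℕ → ℕ → ℕ
  N v u = length (PRFs v u)

  Nᵐ : ℕ → ℕ → ℕ
  Nᵐ v u = length (monicPRFs v u)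

  T₃ : ℕ
  T₃ = sum (List.map (λ v → sum (List.map (λ u → N v u) (upTo 3))) (upTo 3))

-- Two PRFs V/U and V′/U′ agree at a point of F_q only if it is a root of W = V U′ − V′ U, so
-- it suffices to bound by 5 the degree of W ≠ 0, and by 4 when the values at ∞ agree. All
-- numerators have degree at most 3 and all denominators at most 2, which gives the first
-- bound; the coefficient of x⁵ in W is V₃ U′₂ − V′₃ U₂. When the values at ∞ agree it is zero:
-- between two cubic numerators because U₂ is a fixed multiple of V₃ (U₂ = V₃ for
-- monic fractions of degrees (3,2), U₂ = 0 for degrees (3,0)), and between a cubic and a
-- lower numerator because both values are then ∞, which forces the second denominator to
-- have degree at most 1.
-- Fractions of different degrees are different rational functions: two proportional pairs
-- (V , U) and (V′ , U′) are multiples of a common pair, by units if they are coprime.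

module Submission where

open import Defs
open import Data.Nat using (ℕ; _+_; _∸_; _⊔_; _≥_; _>_; zero; suc; _≤_; _<_; z≤n; s≤s)

open import Algebra.Bundles using (AbelianGroup; CommutativeRing; RawSemiring)
import Algebra.Definitions.RawMagma as RawMagmaDefinitions
import Algebra.Definitions.RawSemiring as RawSemiringDefinitions
import Algebra.Properties.AbelianGroup as AbelianGroupProperties
import Algebra.Properties.CommutativeSemigroup as CommutativeSemigroupProperties
import Algebra.Properties.Ring as RingProperties
import Algebra.Solver.Ring.NaturalCoefficients.Default as SemiringSolver
open import Data.Empty using (⊥-elim)
open import Data.Fin.Base using (Fin; zero; suc)
open import Data.Fin.Permutation as Perm using (Permutation′; _⟨$⟩ʳ_)
import Data.Fin.Properties as Fin
open import Data.List.Base as List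
  using (List; []; _∷_; length; filter; deduplicate; allFin; upTo; cartesianProduct; concatMap; lookup; tabulate)
open import Data.List.Membership.Propositional.Properties using (∈-lookup)
import Data.List.Properties as List
open import Data.List.Relation.Unary.All as All using (All; []; _∷_)
import Data.List.Relation.Unary.All.Properties as All
open import Data.List.Relation.Unary.AllPairs using (AllPairs; []; _∷_)
import Data.List.Relation.Unary.AllPairs.Properties as AllPairs
open import Data.List.Relation.Unary.Unique.Propositional using (Unique)
import Data.List.Relation.Unary.Unique.Propositional.Properties as Unique
open import Data.Maybe.Base using (just; nothing)
open import Data.Maybe.Properties using (just-injective)
open import Data.Nat.ListAction using (sum)
import Data.Nat.Properties as ℕ
open import Data.Nat.Tactic.RingSolver using (solve-∀)
open import Data.Product.Base using (∃; ∃₂; _×_; _,_; proj₁; proj₂)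
open import Data.Sum.Base using (_⊎_; inj₁; inj₂)
open import Data.Vec.Base using (Vec; []; _∷_; last; toList)
open import Function.Base using (_∘_; id)
open import Function.Bundles using (_↔_; Inverse; mk↔ₛ′; mk⤖)
open import Function.Construct.Composition using (_↔-∘_)
open import Function.Definitions using (Bijective)
open import Function.Properties.Bijection using (⤖⇒↔)
open import Function.Properties.Inverse using (↔-sym)
open import Level using (0ℓ)
open import Relation.Binary.Bundles using (Setoid)
open import Relation.Binary.Core using (Rel)
open import Relation.Binary.Definitions using (Symmetric; tri<; tri≈; tri>)
open import Relation.Binary.PropositionalEquality
  using (_≡_; _≢_; refl; sym; trans; cong; cong₂; subst; module ≡-Reasoning)
import Relation.Binary.Reasoning.Setoid as SetoidReasoning
open import Relation.Nullary using (Dec; yes; no; ¬_; ¬?; _×-dec_)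
open import Relation.Nullary.Decidable using (from-yes)
open import Relation.Unary using (Pred; Decidable)

-- The commutative ring of polynomials over the field.

module PolynomialRing {q : ℕ} (F : FiniteField q) where
  open FiniteField F renaming (_+_ to _⊕_; _*_ to _·_; -_ to ⊖_)
  open CommutativeRing commutativeRing using (-‿inverseʳ; +-assoc; +-comm; distribˡ; distribʳ)

  -- Wrapping ≈ᴾ in a record lets Agda infer the two polynomials from a proof of equality.
  infix 4 _≈_
  record _≈_ (p r : Poly F) : Set where
    constructor coefficientwise
    field at : ∀ i → coeff F p i ≡ coeff F r i
  open _≈_ public

  infixl 6 _⊞_
  _⊞_ : Poly F → Poly F → Poly F
  _⊞_ = _+ᴾ_ F

  infixl 7 _⊠_
  _⊠_ : Poly F → Poly F → Poly F
  _⊠_ = _*ᴾ_ F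

  scale : Carrier → Poly F → Poly F
  scale a = List.map (a ·_)

  ≈-setoid : Setoid 0ℓ 0ℓ
  ≈-setoid = record
    { _≈_ = _≈_
    ; isEquivalence = record
      { refl  = coefficientwise λ _ → refl
      ; sym   = λ e → coefficientwise λ i → sym (at e i)
      ; trans = λ e f → coefficientwise λ i → trans (at e i) (at f i)
      }
    }

  open Setoid ≈-setoid public using () renaming (refl to ≈-refl; sym to ≈-sym; trans to ≈-trans)
  open SetoidReasoning ≈-setoid

  ∷-cong : ∀ {a b p r} → a ≡ b → p ≈ r → a ∷ p ≈ b ∷ r
  at (∷-cong a≡b p≈r) zero    = a≡b
  at (∷-cong a≡b p≈r) (suc i) = at p≈r i

  0∷[] : 0# ∷ [] ≈ []
  at 0∷[] zero    = refl
  at 0∷[] (suc _) = refl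

  ⊞-cong : ∀ {p p′ r r′} → p ≈ p′ → r ≈ r′ → p ⊞ r ≈ p′ ⊞ r′
  at (⊞-cong {p} {p′} {r} {r′} e f) i = trans (coeff-+ F p r i)
    (trans (cong₂ _⊕_ (at e i) (at f i)) (sym (coeff-+ F p′ r′ i)))

  ⊞-assoc : ∀ p r s → (p ⊞ r) ⊞ s ≈ p ⊞ (r ⊞ s)
  ⊞-assoc []      r       s       = ≈-refl
  ⊞-assoc (a ∷ p) []      s       = ≈-refl
  ⊞-assoc (a ∷ p) (b ∷ r) []      = ≈-refl
  ⊞-assoc (a ∷ p) (b ∷ r) (c ∷ s) = ∷-cong (+-assoc a b c) (⊞-assoc p r s)

  ⊞-comm : ∀ p r → p ⊞ r ≈ r ⊞ p
  ⊞-comm []      []      = ≈-refl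
  ⊞-comm []      (b ∷ r) = ≈-refl
  ⊞-comm (a ∷ p) []      = ≈-refl
  ⊞-comm (a ∷ p) (b ∷ r) = ∷-cong (+-comm a b) (⊞-comm p r)

  ⊞-identityʳ : ∀ p → p ⊞ [] ≈ p
  ⊞-identityʳ p = ⊞-comm p []

  ⊟_ : Poly F → Poly F
  ⊟_ = List.map ⊖_

  coeff-⊟ : ∀ p i → coeff F (⊟ p) i ≡ ⊖ coeff F p i
  coeff-⊟ []      i       = trans (sym (-‿inverseʳ 0#)) (+-identityˡ (⊖ 0#))
  coeff-⊟ (a ∷ p) zero    = refl
  coeff-⊟ (a ∷ p) (suc i) = coeff-⊟ p i

  ⊟-cong : ∀ {p r} → p ≈ r → ⊟ p ≈ ⊟ r
  at (⊟-cong {p} {r} e) i = trans (coeff-⊟ p i) (trans (cong ⊖_ (at e i)) (sym (coeff-⊟ r i)))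

  ⊟-inverseʳ : ∀ p → p ⊞ ⊟ p ≈ []
  ⊟-inverseʳ []      = ≈-refl
  ⊟-inverseʳ (a ∷ p) = ≈-trans (∷-cong (-‿inverseʳ a) (⊟-inverseʳ p)) 0∷[]

  ⊞-abelianGroup : AbelianGroup 0ℓ 0ℓ
  ⊞-abelianGroup = record
    { isAbelianGroup = record
      { isGroup = record
        { isMonoid = record
          { isSemigroup = record
            { isMagma = record
              { isEquivalence = Setoid.isEquivalence ≈-setoid
              ; ∙-cong = ⊞-cong
              }
            ; assoc = ⊞-assoc
            }
          ; identity = (λ _ → ≈-refl) , ⊞-identityʳ
          }
        ; inverse = (λ p → ≈-trans (⊞-comm (⊟ p) p) (⊟-inverseʳ p)) , ⊟-inverseʳ
        ; ⁻¹-cong = ⊟-cong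
        }
      ; comm = ⊞-comm
      }
    }

  open CommutativeSemigroupProperties (AbelianGroup.commutativeSemigroup ⊞-abelianGroup)
    using (interchange)

  scale-⊞ : ∀ a p r → scale a (p ⊞ r) ≈ scale a p ⊞ scale a r
  scale-⊞ a []      r       = ≈-refl
  scale-⊞ a (b ∷ p) []      = ≈-refl
  scale-⊞ a (b ∷ p) (c ∷ r) = ∷-cong (distribˡ a b c) (scale-⊞ a p r)

  ⊕-scale : ∀ a b p → scale (a ⊕ b) p ≈ scale a p ⊞ scale b p
  ⊕-scale a b []      = ≈-refl
  ⊕-scale a b (c ∷ p) = ∷-cong (distribʳ c a b) (⊕-scale a b p)

  scale-scale : ∀ a b p → scale (a · b) p ≈ scale a (scale b p)
  scale-scale a b []      = ≈-refl
  scale-scale a b (c ∷ p) = ∷-cong (*-assoc a b c) (scale-scale a b p)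

  scale-0 : ∀ p → scale 0# p ≈ []
  scale-0 []      = ≈-refl
  scale-0 (a ∷ p) = ≈-trans (∷-cong (zeroˡ a) (scale-0 p)) 0∷[]

  scale-1 : ∀ p → scale 1# p ≈ p
  scale-1 []      = ≈-refl
  scale-1 (a ∷ p) = ∷-cong (*-identityˡ a) (scale-1 p)

  ⊠-cong : ∀ {p p′ r r′} → p ≈ p′ → r ≈ r′ → p ⊠ r ≈ p′ ⊠ r′
  ⊠-cong {p} {p′} {r} {r′} e f = begin
    p ⊠ r    ≈⟨ coefficientwise (*-congʳ F p p′ r (at e)) ⟩
    p′ ⊠ r   ≈⟨ coefficientwise (*-congˡ F p′ r r′ (at f)) ⟩
    p′ ⊠ r′  ∎

  ⊠-zeroʳ : ∀ p → p ⊠ [] ≈ []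
  ⊠-zeroʳ []      = ≈-refl
  ⊠-zeroʳ (a ∷ p) = ≈-trans (∷-cong refl (⊠-zeroʳ p)) 0∷[]

  -- Multiplication recurses on its left factor; this is the mirror recursion on the right factor,
  -- from which commutativity follows by induction.
  ⊠-∷ : ∀ p b r → p ⊠ (b ∷ r) ≈ scale b p ⊞ (0# ∷ p ⊠ r)
  ⊠-∷ []      b r = ≈-sym 0∷[]
  ⊠-∷ (a ∷ p) b r = ∷-cong (cong (_⊕ 0#) (*-comm a b)) (begin
    scale a r ⊞ p ⊠ (b ∷ r)                  ≈⟨ ⊞-cong ≈-refl (⊠-∷ p b r) ⟩
    scale a r ⊞ (scale b p ⊞ (0# ∷ p ⊠ r))   ≈⟨ ⊞-assoc (scale a r) (scale b p) _ ⟨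
    scale a r ⊞ scale b p ⊞ (0# ∷ p ⊠ r)     ≈⟨ ⊞-cong (⊞-comm (scale a r) (scale b p)) ≈-refl ⟩
    scale b p ⊞ scale a r ⊞ (0# ∷ p ⊠ r)     ≈⟨ ⊞-assoc (scale b p) (scale a r) _ ⟩
    scale b p ⊞ (scale a r ⊞ (0# ∷ p ⊠ r))   ∎)

  ⊠-comm : ∀ p r → p ⊠ r ≈ r ⊠ p
  ⊠-comm []      r = ≈-sym (⊠-zeroʳ r)
  ⊠-comm (a ∷ p) r = begin
    scale a r ⊞ (0# ∷ p ⊠ r)  ≈⟨ ⊞-cong ≈-refl (∷-cong refl (⊠-comm p r)) ⟩
    scale a r ⊞ (0# ∷ r ⊠ p)  ≈⟨ ⊠-∷ r a p ⟨
    r ⊠ (a ∷ p)               ∎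

  ⊠-distribʳ : ∀ s p r → (p ⊞ r) ⊠ s ≈ p ⊠ s ⊞ r ⊠ s
  ⊠-distribʳ s []      r       = ≈-refl
  ⊠-distribʳ s (a ∷ p) []      = ≈-sym (⊞-identityʳ _)
  ⊠-distribʳ s (a ∷ p) (b ∷ r) = begin
    scale (a ⊕ b) s ⊞ (0# ∷ (p ⊞ r) ⊠ s)
      ≈⟨ ⊞-cong (⊕-scale a b s) (∷-cong (sym (+-identityˡ 0#)) (⊠-distribʳ s p r)) ⟩
    (scale a s ⊞ scale b s) ⊞ ((0# ∷ p ⊠ s) ⊞ (0# ∷ r ⊠ s))
      ≈⟨ interchange (scale a s) (scale b s) (0# ∷ p ⊠ s) (0# ∷ r ⊠ s) ⟩
    (scale a s ⊞ (0# ∷ p ⊠ s)) ⊞ (scale b s ⊞ (0# ∷ r ⊠ s))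
      ∎

  ⊠-distribˡ : ∀ s p r → s ⊠ (p ⊞ r) ≈ s ⊠ p ⊞ s ⊠ r
  ⊠-distribˡ s p r = begin
    s ⊠ (p ⊞ r)    ≈⟨ ⊠-comm s (p ⊞ r) ⟩
    (p ⊞ r) ⊠ s    ≈⟨ ⊠-distribʳ s p r ⟩
    p ⊠ s ⊞ r ⊠ s  ≈⟨ ⊞-cong (⊠-comm p s) (⊠-comm r s) ⟩
    s ⊠ p ⊞ s ⊠ r  ∎

  scale-⊠ : ∀ a p r → scale a p ⊠ r ≈ scale a (p ⊠ r)
  scale-⊠ a []      r = ≈-refl
  scale-⊠ a (b ∷ p) r = begin
    scale (a · b) r ⊞ (0# ∷ scale a p ⊠ r)
      ≈⟨ ⊞-cong (scale-scale a b r) (∷-cong (sym (zeroʳ a)) (scale-⊠ a p r)) ⟩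
    scale a (scale b r) ⊞ scale a (0# ∷ p ⊠ r)
      ≈⟨ scale-⊞ a (scale b r) (0# ∷ p ⊠ r) ⟨
    scale a (scale b r ⊞ (0# ∷ p ⊠ r))
      ∎

  ⊠-assoc : ∀ p r s → (p ⊠ r) ⊠ s ≈ p ⊠ (r ⊠ s)
  ⊠-assoc []      r s = ≈-refl
  ⊠-assoc (a ∷ p) r s = begin
    (scale a r ⊞ (0# ∷ p ⊠ r)) ⊠ s
      ≈⟨ ⊠-distribʳ s (scale a r) (0# ∷ p ⊠ r) ⟩
    -- The second summand is `(0# ∷ p ⊠ r) ⊠ s` unfolded; its part `scale 0# s` is zero.
    scale a r ⊠ s ⊞ (scale 0# s ⊞ (0# ∷ (p ⊠ r) ⊠ s))
      ≈⟨ ⊞-cong (scale-⊠ a r s) (⊞-cong (scale-0 s) (∷-cong refl (⊠-assoc p r s))) ⟩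
    scale a (r ⊠ s) ⊞ (0# ∷ p ⊠ (r ⊠ s))
      ∎

  ⊠-identityˡ : ∀ p → 1ᴾ F ⊠ p ≈ p
  ⊠-identityˡ p = begin
    scale 1# p ⊞ (0# ∷ [])  ≈⟨ ⊞-cong (scale-1 p) 0∷[] ⟩
    p ⊞ []                  ≈⟨ ⊞-identityʳ p ⟩
    p                       ∎

  -- Packaged so that the semiring solver and the general laws of negation apply to the polynomial
  -- identities in Euclid's algorithm.
  polynomialRing : CommutativeRing 0ℓ 0ℓ
  polynomialRing = record
    { Carrier = Poly F
    ; _≈_ = _≈_
    ; _+_ = _⊞_
    ; _*_ = _⊠_
    ; -_  = ⊟_
    ; 0#  = []
    ; 1#  = 1ᴾ F
    ; isCommutativeRing = record
      { isRing = record
        { +-isAbelianGroup = AbelianGroup.isAbelianGroup ⊞-abelianGroup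
        ; *-cong = ⊠-cong
        ; *-assoc = ⊠-assoc
        ; *-identity = ⊠-identityˡ , λ p → ≈-trans (⊠-comm p (1ᴾ F)) (⊠-identityˡ p)
        ; distrib = ⊠-distribˡ , ⊠-distribʳ
        }
      ; *-comm = ⊠-comm
      }
    }

-- Evaluation, division by a linear factor, and the bound on the number of roots.

module Evaluation {q : ℕ} (F : FiniteField q) where
  open FiniteField F renaming (_+_ to _⊕_; _*_ to _·_; -_ to ⊖_)
  open CommutativeRing commutativeRing using (-‿inverseʳ; +-assoc; +-comm; ring; +-abelianGroup)
  open RingProperties ring using (-‿distribʳ-*)
  open AbelianGroupProperties +-abelianGroup using (⁻¹-∙-comm; x∙y⁻¹≈ε⇒x≈y)
  open PolynomialRing F
  open SemiringSolver (CommutativeRing.commutativeSemiring commutativeRing)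
    using (solve; _:=_; _:+_; _:*_)

  eval-≈[] : ∀ p x → p ≈ [] → eval F p x ≡ 0#
  eval-≈[] []      x e = refl
  eval-≈[] (a ∷ p) x e = trans
    (cong₂ (λ b c → b ⊕ x · c) (at e 0) (eval-≈[] p x (coefficientwise (at e ∘ suc))))
    (trans (+-identityˡ _) (zeroʳ x))

  eval-⊞ : ∀ p r x → eval F (p ⊞ r) x ≡ eval F p x ⊕ eval F r x
  eval-⊞ []      r       x = sym (+-identityˡ _)
  eval-⊞ (a ∷ p) []      x = sym (+-identityʳ _)
  eval-⊞ (a ∷ p) (b ∷ r) x = trans (cong (λ y → (a ⊕ b) ⊕ x · y) (eval-⊞ p r x))
    (solve 5 (λ a b x y z → (a :+ b) :+ x :* (y :+ z) := (a :+ x :* y) :+ (b :+ x :* z)) refl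
      a b x (eval F p x) (eval F r x))

  eval-scale : ∀ a p x → eval F (scale a p) x ≡ a · eval F p x
  eval-scale a []      x = sym (zeroʳ a)
  eval-scale a (b ∷ p) x = trans (cong (λ y → a · b ⊕ x · y) (eval-scale a p x))
    (solve 4 (λ a b x y → a :* b :+ x :* (a :* y) := a :* (b :+ x :* y)) refl a b x (eval F p x))

  eval-⊟ : ∀ p x → eval F (⊟ p) x ≡ ⊖ eval F p x
  eval-⊟ []      x = trans (sym (-‿inverseʳ 0#)) (+-identityˡ (⊖ 0#))
  eval-⊟ (a ∷ p) x = trans (cong (λ y → ⊖ a ⊕ x · y) (eval-⊟ p x))
    (trans (cong (⊖ a ⊕_) (sym (-‿distribʳ-* x _))) (⁻¹-∙-comm a _))

  eval-⊠ : ∀ p r x → eval F (p ⊠ r) x ≡ eval F p x · eval F r x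
  eval-⊠ []      r x = sym (zeroˡ _)
  eval-⊠ (a ∷ p) r x = trans (eval-⊞ (scale a r) (0# ∷ p ⊠ r) x)
    (trans (cong₂ _⊕_ (eval-scale a r x) (trans (+-identityˡ _) (cong (x ·_) (eval-⊠ p r x))))
      (solve 4 (λ a x y z → a :* z :+ x :* (y :* z) := (a :+ x :* y) :* z) refl
        a x (eval F p x) (eval F r x)))

  -- The quotient of p by x − c (synthetic division); the remainder is eval p c.
  quotient : Carrier → Poly F → Poly F
  quotient c []      = []
  quotient c (a ∷ p) = eval F p c ∷ quotient c p

  -- Division with remainder evaluated at b, with d standing for b − c so that no subtraction occurs.
  quotient-eval : ∀ c d p → let b = d ⊕ c in
    eval F p b ≡ d · eval F (quotient c p) b ⊕ eval F p c
  quotient-eval c d []      = sym (trans (+-identityʳ _) (zeroʳ d))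
  quotient-eval c d (a ∷ p) = trans (cong (λ y → a ⊕ (d ⊕ c) · y) (quotient-eval c d p))
    (solve 5 (λ a d c P Q → a :+ (d :+ c) :* (d :* Q :+ P) := d :* (P :+ (d :+ c) :* Q) :+ (a :+ c :* P))
      refl a d c (eval F p c) (eval F (quotient c p) (d ⊕ c)))

  VanishesFrom : ℕ → Poly F → Set
  VanishesFrom n p = ∀ i → n ≤ i → coeff F p i ≡ 0#

  -- The coefficient of the quotient at index `i` is the value at `c` of what remains of `p` after
  -- its first `i + 1` coefficients are dropped, so it is zero once those remaining coefficients
  -- are.
  quotient-vanishes : ∀ c p {n} → VanishesFrom (suc n) p → VanishesFrom n (quotient c p)
  quotient-vanishes c []      v i       n≤i     = refl
  quotient-vanishes c (a ∷ p) v zero    z≤n     =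
    eval-≈[] p c (coefficientwise λ i → v (suc i) (s≤s z≤n))
  quotient-vanishes c (a ∷ p) {zero}  v (suc i) z≤n =
    quotient-vanishes c p (λ { (suc j) _ → v (suc (suc j)) (s≤s z≤n) }) i z≤n
  quotient-vanishes c (a ∷ p) {suc n} v (suc i) (s≤s n≤i) =
    quotient-vanishes c p (λ { (suc j) (s≤s n≤j) → v (suc (suc j)) (s≤s (s≤s n≤j)) }) i n≤i

  -- This is p = (x - c) · quotient + p(c) with both terms zero. The head of the quotient is the
  -- value of the tail of `p` at `c`, so the tail again has the root `c` and induction applies.
  quotient-≈[] : ∀ c p → eval F p c ≡ 0# → quotient c p ≈ [] → p ≈ []
  quotient-≈[] c []      root e = ≈-refl
  quotient-≈[] c (a ∷ p) root e = ≈-trans (∷-cong a≡0 p≈[]) 0∷[]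
    where
    p≈[] = quotient-≈[] c p (at e 0) (coefficientwise (at e ∘ suc))
    a≡0 : a ≡ 0#
    a≡0 = trans (sym (trans (cong (λ y → a ⊕ c · y) (at e 0)) (trans (cong (a ⊕_) (zeroʳ c)) (+-identityʳ a)))) root

  -- From p(b) = (b - c) · quotient(b) + p(c) with both values of p zero: b - c is nonzero and a
  -- field has no zero divisors.
  quotient-root : ∀ b c p → c ≢ b → eval F p c ≡ 0# → eval F p b ≡ 0# → eval F (quotient c p) b ≡ 0#
  quotient-root b c p c≢b pc≡0 pb≡0 with eval F (quotient c p) b ≟ 0#
  ... | yes e  = e
  ... | no qb≢0 = ⊥-elim (*-nonzero F d≢0 qb≢0 (begin
      d · eval F (quotient c p) b              ≡⟨ +-identityʳ _ ⟨
      d · eval F (quotient c p) b ⊕ 0#         ≡⟨ cong₂ (λ x y → d · eval F (quotient c p) x ⊕ y) d⊕c≡b pc≡0 ⟨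
      d · eval F (quotient c p) (d ⊕ c) ⊕ eval F p c  ≡⟨ quotient-eval c d p ⟨
      eval F p (d ⊕ c)                         ≡⟨ cong (eval F p) d⊕c≡b ⟩
      eval F p b                               ≡⟨ pb≡0 ⟩
      0#                                       ∎))
    where
    open ≡-Reasoning
    d = b ⊕ ⊖ c
    d⊕c≡b : d ⊕ c ≡ b
    d⊕c≡b = trans (+-assoc b (⊖ c) c)
      (trans (cong (b ⊕_) (trans (+-comm (⊖ c) c) (-‿inverseʳ c))) (+-identityʳ b))
    d≢0 : d ≢ 0#
    d≢0 d≡0 = c≢b (sym (x∙y⁻¹≈ε⇒x≈y b c d≡0))

  -- Induction on the roots: dividing by x - c lowers the bound on the degree by one and keeps every
  -- root other than `c`.
  enough-roots⇒≈[] : ∀ rs p → VanishesFrom (length rs) p →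
    Unique rs → All (λ b → eval F p b ≡ 0#) rs → p ≈ []
  enough-roots⇒≈[] []       p v []        []           = coefficientwise λ i → v i z≤n
  enough-roots⇒≈[] (c ∷ rs) p v (c∉ ∷ rs!) (pc≡0 ∷ roots) = quotient-≈[] c p pc≡0
    (enough-roots⇒≈[] rs (quotient c p) (quotient-vanishes c p v) rs!
      (All.zipWith (λ {b} (c≢b , pb≡0) → quotient-root b c p c≢b pc≡0 pb≡0) (c∉ , roots)))

  -- With more than `d` points of agreement, the difference `p ⊞ ⊟ r` has degree at most `d` and
  -- more than `d` roots, so it is zero.
  agreement-bound : ∀ p r d rs → (∀ i → d < i → coeff F p i ≡ coeff F r i) → ¬ p ≈ r →
    Unique rs → All (λ b → eval F p b ≡ eval F r b) rs → length rs ≤ d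
  agreement-bound p r d rs agree p≉r rs! same = ℕ.≮⇒≥ λ d<n → p≉r (coefficientwise λ i →
    x∙y⁻¹≈ε⇒x≈y _ _ (trans (sym (coeff-difference i))
      (at (enough-roots⇒≈[] rs (p ⊞ ⊟ r)
        (λ i n≤i → trans (coeff-difference i) (difference (agree i (ℕ.<-≤-trans d<n n≤i)))) rs!
        (All.map (λ {b} e → trans (eval-⊞ p (⊟ r) b)
          (trans (cong (eval F p b ⊕_) (eval-⊟ r b)) (difference e))) same)) i)))
    where
    coeff-difference : ∀ i → coeff F (p ⊞ ⊟ r) i ≡ coeff F p i ⊕ ⊖ coeff F r i
    coeff-difference i = trans (coeff-+ F p (⊟ r) i) (cong (coeff F p i ⊕_) (coeff-⊟ r i))
    difference : ∀ {a b} → a ≡ b → a ⊕ ⊖ b ≡ 0#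
    difference refl = -‿inverseʳ _

-- Degrees, and proportional pairs of polynomials.

module Proportional {q : ℕ} (F : FiniteField q) where
  open FiniteField F renaming (_+_ to _⊕_; _*_ to _·_; -_ to ⊖_)
  open CommutativeRing commutativeRing using (-‿inverseʳ; *-identityʳ; ring)
  open RingProperties ring using (-‿distribˡ-*)
  open PolynomialRing F
  open SemiringSolver (CommutativeRing.commutativeSemiring polynomialRing)
    using (solve; _:=_; _:+_; _:*_)
  open RawSemiringDefinitions (polynomials F) using (Coprime)
  open RawMagmaDefinitions (RawSemiring.*-rawMagma (polynomials F)) using (_,_)

  degree-cong : ∀ {p r d} → p ≈ r → HasDegree F p d → HasDegree F r d
  degree-cong e (lead , above) =
    lead ∘ trans (at e _) , λ i d<i → trans (sym (at e i)) (above i d<i)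

  degree-unique : ∀ {p d e} → HasDegree F p d → HasDegree F p e → d ≡ e
  degree-unique {d = d} {e} (pd , vd) (pe , ve) with ℕ.<-cmp d e
  ... | tri< d<e _ _ = ⊥-elim (pe (vd e d<e))
  ... | tri≈ _ d≡e _ = d≡e
  ... | tri> _ _ e<d = ⊥-elim (pd (ve d e<d))

  ≈[]-no-degree : ∀ {p d} → p ≈ [] → ¬ HasDegree F p d
  ≈[]-no-degree e (lead , _) = lead (at e _)

  -- `top-coeff` accepts any upper bounds for the degrees. Writing `i` as `(i ∸ e) + e` and using
  -- the bound `i ∸ e` for `p`, the coefficient becomes a product whose first factor lies beyond
  -- `d`.
  ⊠-vanishes : ∀ p r d e → VanishesAbove F p d → VanishesAbove F r e → VanishesAbove F (p ⊠ r) (d + e)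
  ⊠-vanishes p r d e vp vr i d+e<i = begin
    coeff F (p ⊠ r) i                  ≡⟨ cong (coeff F (p ⊠ r)) (ℕ.m∸n+n≡m (ℕ.≤-trans (ℕ.m≤n+m e d) (ℕ.<⇒≤ d+e<i))) ⟨
    coeff F (p ⊠ r) (i ∸ e + e)        ≡⟨ top-coeff F p r (i ∸ e) e (λ j i∸e<j → vp j (ℕ.<-trans d<i∸e i∸e<j)) vr ⟩
    coeff F p (i ∸ e) · coeff F r e    ≡⟨ cong (_· coeff F r e) (vp (i ∸ e) d<i∸e) ⟩
    0# · coeff F r e                   ≡⟨ zeroˡ _ ⟩
    0#                                 ∎
    where
    open ≡-Reasoning
    d<i∸e : d < i ∸ e
    d<i∸e = ℕ.m+n≤o⇒m≤o∸n (suc d) d+e<i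

  ⊠-degree : ∀ {p r d e} → HasDegree F p d → HasDegree F r e → HasDegree F (p ⊠ r) (d + e)
  ⊠-degree {p} {r} {d} {e} (pd , vp) (re , vr) =
      (λ 0≡ → *-nonzero F pd re (trans (sym (top-coeff F p r d e vp vr)) 0≡))
    , ⊠-vanishes p r d e vp vr

  factor-degree : ∀ {p r s d} → p ⊠ r ≈ s → HasDegree F s d → ∃ (HasDegree F p)
  factor-degree {p} {r} {s} e deg with zero-or-degree F p
  ... | inj₂ degp = degp
  ... | inj₁ p≈0  = ⊥-elim (≈[]-no-degree {s} (≈-trans (≈-sym e) (⊠-cong {p} {[]} {r} (coefficientwise p≈0) ≈-refl)) deg)

  ⊠-zero : ∀ {p r d} → HasDegree F r d → p ⊠ r ≈ [] → p ≈ []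
  ⊠-zero {p} degr e with zero-or-degree F p
  ... | inj₁ p≈0        = coefficientwise p≈0
  ... | inj₂ (_ , degp) = ⊥-elim (≈[]-no-degree e (⊠-degree {p} degp degr))

  -- Both pairs are multiples of (`S`, `R`). Each multiplier is a common divisor of its pair, hence
  -- a unit when that pair is coprime.
  record CommonForm (V U V′ U′ : Poly F) : Set where
    field
      S R t t′ : Poly F
      S⊠t  : S ⊠ t ≈ V
      R⊠t  : R ⊠ t ≈ U
      S⊠t′ : S ⊠ t′ ≈ V′
      R⊠t′ : R ⊠ t′ ≈ U′

  CommonForm-sym : ∀ {V U V′ U′} → CommonForm V U V′ U′ → CommonForm V′ U′ V U
  CommonForm-sym c = record
    { S = S ; R = R ; t = t′ ; t′ = t ; S⊠t = S⊠t′ ; R⊠t = R⊠t′ ; S⊠t′ = S⊠t ; R⊠t′ = R⊠t }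
    where open CommonForm c

  -- Undoes a step of Euclid's algorithm: adding `m` times the first pair to the second keeps `S`
  -- and `R` and changes only the second multiplier, from `t′` to `t′ ⊞ m ⊠ t`.
  CommonForm-shift : ∀ {V U V″ U″ V′ U′} m → V″ ⊞ m ⊠ V ≈ V′ → U″ ⊞ m ⊠ U ≈ U′ →
    CommonForm V U V″ U″ → CommonForm V U V′ U′
  CommonForm-shift m eV eU c = record
    { S = S ; R = R ; t = t ; t′ = t′ ⊞ m ⊠ t ; S⊠t = S⊠t ; R⊠t = R⊠t
    ; S⊠t′ = shift S S⊠t S⊠t′ eV ; R⊠t′ = shift R R⊠t R⊠t′ eU }
    where
    open CommonForm c
    shift : ∀ s {v v″ v′} → s ⊠ t ≈ v → s ⊠ t′ ≈ v″ → v″ ⊞ m ⊠ v ≈ v′ → s ⊠ (t′ ⊞ m ⊠ t) ≈ v′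
    shift s {v} {v″} {v′} e e″ e′ = begin
      s ⊠ (t′ ⊞ m ⊠ t)        ≈⟨ solve 4 (λ s t t′ m → s :* (t′ :+ m :* t) := s :* t′ :+ m :* (s :* t)) ≈-refl s t t′ m ⟩
      s ⊠ t′ ⊞ m ⊠ (s ⊠ t)    ≈⟨ ⊞-cong e″ (⊠-cong {m} ≈-refl e) ⟩
      v″ ⊞ m ⊠ v              ≈⟨ e′ ⟩
      v′                      ∎
      where open SetoidReasoning ≈-setoid

  monomial : Carrier → ℕ → Poly F
  monomial c zero    = c ∷ []
  monomial c (suc k) = 0# ∷ monomial c k

  monomial-lead : ∀ c k → coeff F (monomial c k) k ≡ c
  monomial-lead c zero    = refl
  monomial-lead c (suc k) = monomial-lead c k

  monomial-vanishes : ∀ c k → VanishesAbove F (monomial c k) k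
  monomial-vanishes c zero    (suc i) _         = refl
  monomial-vanishes c (suc k) (suc i) (s≤s k<i) = monomial-vanishes c k i k<i

  -- One step of long division: `m` is the monomial of degree `d′ ∸ d` whose coefficient is minus
  -- the ratio of the leading coefficients, so the terms of degree `d′` cancel.
  cancel-lead : ∀ U U′ d d′ → d ≤ d′ → HasDegree F U d → HasDegree F U′ d′ →
    ∃ λ m → ∀ i → d′ ≤ i → coeff F (U′ ⊞ m ⊠ U) i ≡ 0#
  cancel-lead U U′ d d′ d≤d′ (Ud , vU) (_ , vU′) = m , vanish
    where
    open ≡-Reasoning
    k = d′ ∸ d
    c = ⊖ (coeff F U′ d′ · coeff F U d ⁻¹)
    m = monomial c k
    k+d≡d′ : k + d ≡ d′
    k+d≡d′ = ℕ.m∸n+n≡m d≤d′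
    top : coeff F (m ⊠ U) d′ ≡ ⊖ coeff F U′ d′
    top = begin
      coeff F (m ⊠ U) d′               ≡⟨ cong (coeff F (m ⊠ U)) k+d≡d′ ⟨
      coeff F (m ⊠ U) (k + d)          ≡⟨ top-coeff F m U k d (monomial-vanishes c k) vU ⟩
      coeff F m k · coeff F U d        ≡⟨ cong (_· coeff F U d) (monomial-lead c k) ⟩
      c · coeff F U d                  ≡⟨ -‿distribˡ-* _ _ ⟨
      ⊖ (coeff F U′ d′ · coeff F U d ⁻¹ · coeff F U d)    ≡⟨ cong ⊖_ (*-assoc _ _ _) ⟩
      ⊖ (coeff F U′ d′ · (coeff F U d ⁻¹ · coeff F U d))  ≡⟨ cong (λ y → ⊖ (coeff F U′ d′ · y)) (trans (*-comm _ _) (*-inverseʳ _ Ud)) ⟩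
      ⊖ (coeff F U′ d′ · 1#)           ≡⟨ cong ⊖_ (*-identityʳ _) ⟩
      ⊖ coeff F U′ d′                  ∎
    vanish : ∀ i → d′ ≤ i → coeff F (U′ ⊞ m ⊠ U) i ≡ 0#
    vanish i d′≤i with ℕ.m≤n⇒m<n∨m≡n d′≤i
    ... | inj₁ d′<i = trans (coeff-+ F U′ (m ⊠ U) i) (trans
      (cong₂ _⊕_ (vU′ i d′<i) (⊠-vanishes m U k d (monomial-vanishes c k) vU i (subst (_< i) (sym k+d≡d′) d′<i)))
      (+-identityˡ 0#))
    ... | inj₂ refl = trans (coeff-+ F U′ (m ⊠ U) d′)
      (trans (cong (coeff F U′ d′ ⊕_) top) (-‿inverseʳ _))

  -- Euclid's algorithm on the denominators, carrying the numerators along: each step keeps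
  -- V U′ = V′ U, and the pair left when the other one vanishes divides both fractions.
  common-form : ∀ n {V U V′ U′ d d′} → d + d′ < n → HasDegree F U d → HasDegree F U′ d′ →
    V ⊠ U′ ≈ V′ ⊠ U → CommonForm V U V′ U′

  common-form-≤ : ∀ n {V U V′ U′ d d′} → d ≤ d′ → d + d′ < suc n → HasDegree F U d → HasDegree F U′ d′ →
    V ⊠ U′ ≈ V′ ⊠ U → CommonForm V U V′ U′

  -- `n` strictly bounds the sum of the denominator degrees and decreases with each step. By
  -- symmetry the denominator to be reduced may be taken to be the second.
  common-form (suc n) {V} {U} {V′} {U′} {d} {d′} d+d′<n degU degU′ e with ℕ.≤-total d d′
  ... | inj₁ d≤d′ = common-form-≤ n d≤d′ d+d′<n degU degU′ e
  ... | inj₂ d′≤d = CommonForm-sym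
    (common-form-≤ n d′≤d (subst (_< suc n) (ℕ.+-comm d d′) d+d′<n) degU′ degU (≈-sym e))

  common-form-≤ n {V} {U} {V′} {U′} {d} {d′} d≤d′ (s≤s d+d′≤n) degU degU′ e
    with cancel-lead U U′ d d′ d≤d′ degU degU′
  ... | m , vanish = CommonForm-shift (⊟ m) (restore V′ V) (restore U′ U) reduced
    where
    open SetoidReasoning ≈-setoid
    open CommutativeRing polynomialRing using () renaming (ring to polyRing)
    open RingProperties polyRing using () renaming (-‿distribˡ-* to ⊟-distribˡ-⊠)
    V″ = V′ ⊞ m ⊠ V
    U″ = U′ ⊞ m ⊠ U

    restore : ∀ p r → (p ⊞ m ⊠ r) ⊞ (⊟ m) ⊠ r ≈ p
    restore p r = begin
      (p ⊞ m ⊠ r) ⊞ (⊟ m) ⊠ r     ≈⟨ ⊞-assoc p (m ⊠ r) _ ⟩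
      p ⊞ (m ⊠ r ⊞ (⊟ m) ⊠ r)     ≈⟨ ⊞-cong {p} ≈-refl (⊠-distribʳ r m (⊟ m)) ⟨
      p ⊞ (m ⊞ ⊟ m) ⊠ r           ≈⟨ ⊞-cong {p} ≈-refl (⊠-cong {r = r} (⊟-inverseʳ m) ≈-refl) ⟩
      p ⊞ []                      ≈⟨ ⊞-identityʳ p ⟩
      p                           ∎

    e″ : V ⊠ U″ ≈ V″ ⊠ U
    e″ = begin
      V ⊠ (U′ ⊞ m ⊠ U)        ≈⟨ solve 4 (λ V U U′ m → V :* (U′ :+ m :* U) := V :* U′ :+ m :* V :* U) ≈-refl V U U′ m ⟩
      V ⊠ U′ ⊞ m ⊠ V ⊠ U      ≈⟨ ⊞-cong e ≈-refl ⟩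
      V′ ⊠ U ⊞ m ⊠ V ⊠ U      ≈⟨ ⊠-distribʳ U V′ (m ⊠ V) ⟨
      (V′ ⊞ m ⊠ V) ⊠ U        ∎

    reduced : CommonForm V U V″ U″
    reduced with zero-or-degree F U″
    -- The algorithm stops: as `U` is nonzero, `e″` makes `V″` zero too, so the first pair itself
    -- serves as (`S`, `R`).
    ... | inj₁ U″≈0 = record
      { S = V ; R = U ; t = 1ᴾ F ; t′ = []
      ; S⊠t  = CommutativeRing.*-identityʳ polynomialRing V
      ; R⊠t  = CommutativeRing.*-identityʳ polynomialRing U
      ; S⊠t′ = ≈-trans (⊠-zeroʳ V) (≈-sym V″≈[])
      ; R⊠t′ = ≈-trans (⊠-zeroʳ U) (≈-sym (coefficientwise U″≈0))
      }
      where
      V″≈[] : V″ ≈ []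
      V″≈[] = ⊠-zero degU (≈-trans (≈-sym e″) (≈-trans (⊠-cong {V} ≈-refl (coefficientwise U″≈0)) (⊠-zeroʳ V)))
    ... | inj₂ (d″ , degU″) = common-form n (ℕ.<-≤-trans (ℕ.+-monoʳ-< d d″<d′) d+d′≤n) degU degU″ e″
      where
      d″<d′ : d″ < d′
      d″<d′ = ℕ.≰⇒> λ d′≤d″ → proj₁ degU″ (vanish d″ d′≤d″)

  -- Degrees add in a product, so a factor of 1 is a nonzero constant.
  divisor-of-1-degree : ∀ {r t} → r ⊠ t ≈ 1ᴾ F → HasDegree F t 0
  divisor-of-1-degree {r} {t} e =
    subst (HasDegree F t) (ℕ.n≤0⇒n≡0 (ℕ.≮⇒≥ λ 0<k → proj₁ degt (vt k 0<k))) degt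
    where
    degree-1 : HasDegree F (1ᴾ F) 0
    degree-1 = 0#≢1# ∘ sym , λ { (suc i) _ → refl }
    vt = proj₂ (factors-vanish F r t (1ᴾ F) 0 degree-1 (at e))
    t-degree = factor-degree {t} {r} (≈-trans (⊠-comm t r) e) degree-1
    k = proj₁ t-degree
    degt = proj₂ t-degree

  unit-multiple-degree : ∀ {s t p d} → s ⊠ t ≈ p → HasDegree F t 0 → HasDegree F p d → HasDegree F s d
  unit-multiple-degree {s} {t} {p} {d} e degt degp =
    subst (HasDegree F s) (trans (sym (ℕ.+-identityʳ k)) (degree-unique {p} (degree-cong e (⊠-degree {s} degs degt)) degp)) degs
    where
    s-degree = factor-degree {s} {t} e degp
    k = proj₁ s-degree
    degs = proj₂ s-degree

  -- Coprimality turns `t` and `t′` into nonzero constants, so both numerators have the degree of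
  -- `S` and both denominators that of `R`.
  reduced-degrees : ∀ {V U V′ U′ v u v′ u′} →
    HasDegree F V v → HasDegree F U u → HasDegree F V′ v′ → HasDegree F U′ u′ →
    Coprime V U → Coprime V′ U′ → V ⊠ U′ ≈ V′ ⊠ U → v ≡ v′ × u ≡ u′
  reduced-degrees {V} {U} {V′} {U′} degV degU degV′ degU′ co co′ e =
      degree-unique {S} (unit-multiple-degree {S} {t} S⊠t degt degV) (unit-multiple-degree {S} {t′} S⊠t′ degt′ degV′)
    , degree-unique {R} (unit-multiple-degree {R} {t} R⊠t degt degU) (unit-multiple-degree {R} {t′} R⊠t′ degt′ degU′)
    where
    open CommonForm (common-form _ {V} {U} {V′} {U′} (ℕ.n<1+n _) degU degU′ e)
    unit : ∀ {t p r} → Coprime p r → S ⊠ t ≈ p → R ⊠ t ≈ r → HasDegree F t 0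
    unit {t} co es er with co {t} (S , at es) (R , at er)
    ... | w , ew = divisor-of-1-degree {w} (coefficientwise ew)
    degt  = unit co S⊠t R⊠t
    degt′ = unit co′ S⊠t′ R⊠t′

-- Counting in lists, and pairwise relations.

length-filter-complement : ∀ {A : Set} {P : Pred A 0ℓ} (P? : Decidable P) xs →
  length (filter (¬? ∘ P?) xs) + length (filter P? xs) ≡ length xs
length-filter-complement P? []       = refl
length-filter-complement P? (x ∷ xs) with P? x
... | yes _ = trans (ℕ.+-suc _ _) (cong suc (length-filter-complement P? xs))
... | no  _ = cong suc (length-filter-complement P? xs)

length-filter-map : ∀ {A B : Set} {P : Pred B 0ℓ} (P? : Decidable P) (f : A → B) xs →
  length (filter P? (List.map f xs)) ≡ length (filter (P? ∘ f) xs)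
length-filter-map P? f []       = refl
length-filter-map P? f (x ∷ xs) with P? (f x)
... | yes _ = cong suc (length-filter-map P? f xs)
... | no  _ = length-filter-map P? f xs

length-concatMap : ∀ {A B : Set} (f : A → List B) xs →
  length (concatMap f xs) ≡ sum (List.map (length ∘ f) xs)
length-concatMap f []       = refl
length-concatMap f (x ∷ xs) =
  trans (List.length-++ (f x)) (cong (length (f x) +_) (length-concatMap f xs))

-- `deduplicate` removes from the processed tail everything related to the head; this alone gives
-- the claim, for an arbitrary relation.
deduplicate-AllPairs : ∀ {A : Set} {R : Rel A 0ℓ} (R? : ∀ x y → Dec (R x y)) xs →
  AllPairs (λ x y → ¬ R x y) (deduplicate R? xs)
deduplicate-AllPairs R? []       = []
deduplicate-AllPairs R? (x ∷ xs) =
  All.all-filter (¬? ∘ R? x) (deduplicate R? xs) ∷ AllPairs.filter⁺ (¬? ∘ R? x) (deduplicate-AllPairs R? xs)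

AllPairs-lookup : ∀ {A : Set} {R : Rel A 0ℓ} → Symmetric R → ∀ {xs} → AllPairs R xs →
  ∀ i j → i ≢ j → R (lookup xs i) (lookup xs j)
AllPairs-lookup sy (px ∷ pxs) zero    zero    0≢0 = ⊥-elim (0≢0 refl)
AllPairs-lookup sy (px ∷ pxs) zero    (suc j) _   = All.lookup px (∈-lookup j)
AllPairs-lookup sy (px ∷ pxs) (suc i) zero    _   = sy (All.lookup px (∈-lookup i))
AllPairs-lookup sy (px ∷ pxs) (suc i) (suc j) i≢j = AllPairs-lookup sy pxs i j (i≢j ∘ cong suc)

-- Bijections of the projective line as permutations of q + 1 symbols.

module ProjectiveLine {q : ℕ} (F : FiniteField q) where
  open FiniteField F using (Carrier; enumeration)

  element : Fin q → Carrier
  element = Inverse.from enumeration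

  element-injective : ∀ {i j} → element i ≡ element j → i ≡ j
  element-injective {i} {j} e = trans (sym (Inverse.strictlyInverseˡ enumeration i))
    (trans (cong (Inverse.to enumeration) e) (Inverse.strictlyInverseˡ enumeration j))

  -- Position zero is ∞, so splitting off the head of `allFin (suc q)` separates ∞ from the field
  -- elements.
  point : Fin (suc q) → P¹ F
  point zero    = nothing
  point (suc i) = just (element i)

  position : P¹ F → Fin (suc q)
  position nothing  = zero
  position (just a) = suc (Inverse.to enumeration a)

  position-point : ∀ i → position (point i) ≡ i
  position-point zero    = refl
  position-point (suc i) = cong suc (Inverse.strictlyInverseˡ enumeration i)

  point-position : ∀ x → point (position x) ≡ x
  point-position nothing  = refl
  point-position (just a) = cong just (Inverse.strictlyInverseʳ enumeration a)

  P¹↔Fin : P¹ F ↔ Fin (suc q)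
  P¹↔Fin = mk↔ₛ′ position point position-point point-position

  permutation : (f : P¹ F → P¹ F) → Bijective _≡_ _≡_ f → Permutation′ (suc q)
  permutation f bij = P¹↔Fin ↔-∘ (⤖⇒↔ (mk⤖ bij) ↔-∘ ↔-sym P¹↔Fin)

  module _ {f g : P¹ F → P¹ F} (bf : Bijective _≡_ _≡_ f) (bg : Bijective _≡_ _≡_ g) where

    private
      π = permutation f bf
      σ = permutation g bg

      agree? : Decidable (λ x → π ⟨$⟩ʳ x ≡ σ ⟨$⟩ʳ x)
      agree? x = π ⟨$⟩ʳ x Fin.≟ σ ⟨$⟩ʳ x

      agreement : ∀ x → π ⟨$⟩ʳ x ≡ σ ⟨$⟩ʳ x → f (point x) ≡ g (point x)
      agreement x e = trans (sym (point-position (f (point x))))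
        (trans (cong point e) (point-position (g (point x))))

    -- Agreements and disagreements together fill q + 1 positions, so at most `d + 1` agreements
    -- leave distance at least `q ∸ d`. An agreement at ∞ uses up one of them, which is why the
    -- bound over the field is then `d`.
    hd-permutation : ∀ d →
      (∀ as → Unique as → All (λ a → f (just a) ≡ g (just a)) as → length as ≤ suc d) →
      (f nothing ≡ g nothing →
        ∀ as → Unique as → All (λ a → f (just a) ≡ g (just a)) as → length as ≤ d) →
      q ∸ d ≤ hd π σ
    hd-permutation d fin inf = ℕ.m≤n+o⇒m∸n≤o q d (ℕ.≤-pred (begin
        suc q                                   ≡⟨ List.length-tabulate {n = suc q} id ⟨
        length (allFin (suc q))                 ≡⟨ length-filter-complement agree? (allFin (suc q)) ⟨
        hd π σ + length (filter agree? (allFin (suc q)))  ≤⟨ ℕ.+-monoʳ-≤ (hd π σ) agreements ⟩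
        hd π σ + suc d                          ≡⟨ ℕ.+-comm (hd π σ) (suc d) ⟩
        suc d + hd π σ                          ∎))
      where
      open ℕ.≤-Reasoning
      as : List Carrier
      as = List.map element (filter (agree? ∘ suc) (allFin q))
      as! : Unique as
      as! = Unique.map⁺ element-injective (Unique.filter⁺ (agree? ∘ suc) (Unique.allFin⁺ q))
      same : All (λ a → f (just a) ≡ g (just a)) as
      same = All.map⁺ (All.map (λ {i} → agreement (suc i)) (All.all-filter (agree? ∘ suc) (allFin q)))
      -- `tabulate suc` is the tail of `allFin (suc q)`; it is rewritten as the image of `allFin q`
      -- under `suc` so that the filter can be pulled back.
      length-as : length (filter agree? (tabulate suc)) ≡ length as
      length-as = trans (cong (length ∘ filter agree?) (sym (List.map-tabulate id suc)))
        (trans (length-filter-map agree? suc (allFin q)) (sym (List.length-map element (filter (agree? ∘ suc) (allFin q)))))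
      agreements : length (filter agree? (allFin (suc q))) ≤ suc d
      agreements with agree? zero
      ... | yes e = s≤s (subst (_≤ d) (sym length-as) (inf (agreement zero e) as as! same))
      ... | no  _ = subst (_≤ suc d) (sym length-as) (fin as as! same)

-- Agreements between two fractions.

module Fractions {q : ℕ} (F : FiniteField q) where
  open FiniteField F renaming (_+_ to _⊕_; _*_ to _·_; -_ to ⊖_)
  open CommutativeRing commutativeRing using (*-identityʳ)
  open PolynomialRing F
  open Evaluation F
  open Proportional F
  open ProjectiveLine F

  num den : ∀ {v u} → Fraction F v u → Poly F
  num (V , U) = toList V
  den (V , U) = toList U

  -- _≃_ between fractions of arbitrary degrees.
  infix 4 _≂_
  _≂_ : ∀ {v u v′ u′} → Fraction F v u → Fraction F v′ u′ → Set
  f ≂ g = _≈ᴾ_ F (num f ⊠ den g) (num g ⊠ den f)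

  quotients-equal : ∀ {a b c d} → b ≢ 0# → d ≢ 0# → a · b ⁻¹ ≡ c · d ⁻¹ → a · d ≡ c · b
  quotients-equal {a} {b} {c} {d} b≢0 d≢0 e = begin
    a · d                    ≡⟨ cong (_· d) (divide a b≢0) ⟩
    a · b ⁻¹ · b · d         ≡⟨ cong (λ x → x · b · d) e ⟩
    c · d ⁻¹ · b · d         ≡⟨ *-assoc (c · d ⁻¹) b d ⟩
    c · d ⁻¹ · (b · d)       ≡⟨ cong (c · d ⁻¹ ·_) (*-comm b d) ⟩
    c · d ⁻¹ · (d · b)       ≡⟨ *-assoc (c · d ⁻¹) d b ⟨
    c · d ⁻¹ · d · b         ≡⟨ cong (_· b) (divide c d≢0) ⟨
    c · b                    ∎
    where
    open ≡-Reasoning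
    divide : ∀ x {y} → y ≢ 0# → x ≡ x · y ⁻¹ · y
    divide x {y} y≢0 = sym (trans (*-assoc x (y ⁻¹) y)
      (trans (cong (x ·_) (trans (*-comm (y ⁻¹) y) (*-inverseʳ y y≢0))) (*-identityʳ x)))

  agreement⇒root : ∀ {v u v′ u′} (f : Fraction F v u) (g : Fraction F v′ u′) a →
    value F f (just a) ≡ value F g (just a) →
    eval F (num f ⊠ den g) a ≡ eval F (num g ⊠ den f) a
  agreement⇒root f@(V , U) g@(V′ , U′) a e =
    trans (eval-⊠ (num f) (den g) a) (trans (products e) (sym (eval-⊠ (num g) (den f) a)))
    where
    products : value F f (just a) ≡ value F g (just a) →
      eval F (num f) a · eval F (den g) a ≡ eval F (num g) a · eval F (den f) a
    products e with eval F (toList U) a ≟ 0# | eval F (toList U′) a ≟ 0#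
    -- A common value ∞ means that both denominators vanish, and both products with them. The mixed
    -- cases contradict `e`.
    ... | yes U≡0 | yes U′≡0 = trans (trans (cong (_ ·_) U′≡0) (zeroʳ _)) (sym (trans (cong (_ ·_) U≡0) (zeroʳ _)))
    ... | no  U≢0 | no  U′≢0 = quotients-equal U≢0 U′≢0 (just-injective e)

  coeff-beyond : ∀ {n} (xs : Vec Carrier n) i → n ≤ i → coeff F (toList xs) i ≡ 0#
  coeff-beyond []       i       _         = refl
  coeff-beyond (x ∷ xs) (suc i) (s≤s n≤i) = coeff-beyond xs i n≤i

  value-∞ : ∀ {v u} (f : Fraction F v u) → u < v → value F f nothing ≡ nothing
  value-∞ {v} {u} f u<v with ℕ.<-cmp v u
  ... | tri< _ _ v≯u = ⊥-elim (v≯u u<v)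
  ... | tri≈ _ _ v≯u = ⊥-elim (v≯u u<v)
  ... | tri> _ _ _   = refl

  value-∞⁻¹ : ∀ {v u} (f : Fraction F v u) → value F f nothing ≡ nothing → u < v
  value-∞⁻¹ {v} {u} f e with ℕ.<-cmp v u
  ... | tri> _ _ u<v = u<v

  -- s = 1 covers the monic fractions of degrees (3,2), s = 0 those of degrees (3,0).
  record Admissible (s : Carrier) {v u} (f : Fraction F v u) : Set where
    field
      den≤2 : u ≤ 2
      num≤3 : v ≤ 2 ⊎ v ≡ 3 × coeff F (den f) 2 ≡ s · coeff F (num f) 3

  numerator-vanishes : ∀ {s v u} {f : Fraction F v u} → Admissible s f → VanishesAbove F (num f) 3
  numerator-vanishes {f = f} record { num≤3 = inj₁ v≤2 }        i 3<i =
    coeff-beyond (proj₁ f) i (ℕ.≤-trans (s≤s (ℕ.m≤n⇒m≤1+n v≤2)) 3<i)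
  numerator-vanishes {f = f} record { num≤3 = inj₂ (refl , _) } i 3<i =
    coeff-beyond (proj₁ f) i 3<i

  denominator-vanishes : ∀ {s v u} {f : Fraction F v u} → Admissible s f → VanishesAbove F (den f) 2
  denominator-vanishes {f = f} record { den≤2 = u≤2 } i 2<i =
    coeff-beyond (proj₂ f) i (ℕ.≤-trans (s≤s u≤2) 2<i)

  zero-products : ∀ {a b} → a ≡ 0# → b ≡ 0# → ∀ x y → a · x ≡ b · y
  zero-products refl refl x y = trans (zeroˡ x) (sym (zeroˡ y))

  -- A fraction with cubic numerator takes the value ∞ at ∞; if f does too, then its
  -- denominator has degree at most 1.
  leading-products-low-cubic : ∀ {v u v′ u′} (f : Fraction F v u) (g : Fraction F v′ u′) →
    v ≤ 2 → v′ ≡ 3 → u′ ≤ 2 → value F f nothing ≡ value F g nothing →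
    coeff F (num f) 3 · coeff F (den g) 2 ≡ coeff F (num g) 3 · coeff F (den f) 2
  leading-products-low-cubic f g v≤2 refl u′≤2 e = trans
    (zero-products (coeff-beyond (proj₁ f) 3 (s≤s v≤2)) den-f≡0 _ _) (*-comm _ _)
    where
    den-f≡0 : coeff F (den f) 2 ≡ 0#
    den-f≡0 = coeff-beyond (proj₂ f) 2
      (ℕ.≤-trans (value-∞⁻¹ f (trans e (value-∞ g (s≤s u′≤2)))) v≤2)

  module _ {s v u v′ u′} (f : Fraction F v u) (g : Fraction F v′ u′)
           (af : Admissible s f) (ag : Admissible s g) where

    private
      module f = Admissible af
      module g = Admissible ag

    leading-products : value F f nothing ≡ value F g nothing →
      coeff F (num f) 3 · coeff F (den g) 2 ≡ coeff F (num g) 3 · coeff F (den f) 2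
    leading-products e with f.num≤3 | g.num≤3
    ... | inj₁ v≤2 | inj₁ v′≤2 = zero-products
      (coeff-beyond (proj₁ f) 3 (s≤s v≤2)) (coeff-beyond (proj₁ g) 3 (s≤s v′≤2)) _ _
    ... | inj₁ v≤2 | inj₂ (v′≡3 , _) = leading-products-low-cubic f g v≤2 v′≡3 g.den≤2 e
    ... | inj₂ (v≡3 , _) | inj₁ v′≤2 = sym (leading-products-low-cubic g f v′≤2 v≡3 f.den≤2 (sym e))
    -- Two cubic numerators: the same `s` relates each denominator to its numerator, so both sides
    -- equal `s · a · b`.
    ... | inj₂ (_ , Uf) | inj₂ (_ , Ug) = begin
      a · coeff F (den g) 2   ≡⟨ cong (a ·_) Ug ⟩
      a · (s · b)             ≡⟨ *-comm a (s · b) ⟩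
      s · b · a               ≡⟨ cong (_· a) (*-comm s b) ⟩
      b · s · a               ≡⟨ *-assoc b s a ⟩
      b · (s · a)             ≡⟨ cong (b ·_) Uf ⟨
      b · coeff F (den f) 2   ∎
      where
      open ≡-Reasoning
      a = coeff F (num f) 3
      b = coeff F (num g) 3

    cross-agree-above-5 : ∀ i → 5 < i → coeff F (num f ⊠ den g) i ≡ coeff F (num g ⊠ den f) i
    cross-agree-above-5 i 5<i = trans
      (⊠-vanishes (num f) (den g) 3 2 (numerator-vanishes af) (denominator-vanishes ag) i 5<i)
      (sym (⊠-vanishes (num g) (den f) 3 2 (numerator-vanishes ag) (denominator-vanishes af) i 5<i))

    cross-agree-above-4 : value F f nothing ≡ value F g nothing →
      ∀ i → 4 < i → coeff F (num f ⊠ den g) i ≡ coeff F (num g ⊠ den f) i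
    cross-agree-above-4 e i 4<i with ℕ.m≤n⇒m<n∨m≡n 4<i
    ... | inj₁ 5<i  = cross-agree-above-5 i 5<i
    -- Index 5 is 3 + 2, so the coefficients are the products of the coefficients at 3 and 2.
    ... | inj₂ refl = trans
      (top-coeff F (num f) (den g) 3 2 (numerator-vanishes af) (denominator-vanishes ag))
      (trans (leading-products e)
        (sym (top-coeff F (num g) (den f) 3 2 (numerator-vanishes ag) (denominator-vanishes af))))

    -- Agreements over the field are agreements of the two cross products, which are distinct
    -- polynomials: at most 5 of them, and at most 4 if the values at ∞ agree.
    hd-fractions : ∀ bf bg → ¬ f ≂ g →
      q ∸ 4 ≤ hd (permutation (value F f) bf) (permutation (value F g) bg)
    hd-fractions bf bg f≄g = hd-permutation bf bg 4
      (λ as as! same → bound 5 as cross-agree-above-5 as! same)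
      (λ e as as! same → bound 4 as (cross-agree-above-4 e) as! same)
      where
      bound : ∀ d as → (∀ i → d < i → coeff F (num f ⊠ den g) i ≡ coeff F (num g ⊠ den f) i) →
        Unique as → All (λ a → value F f (just a) ≡ value F g (just a)) as → length as ≤ d
      bound d as agree as! same = agreement-bound (num f ⊠ den g) (num g ⊠ den f) d as agree
        (λ e → f≄g (at e)) as! (All.map (λ {a} → agreement⇒root f g a) same)

  -- Permutation arrays from lists of fractions.

  RationalFunction : Set
  RationalFunction = ∃₂ λ v u → Fraction F v u

  IsPRF′ : RationalFunction → Set
  IsPRF′ (_ , _ , f) = IsPRF F f

  Admissible′ : Carrier → RationalFunction → Set
  Admissible′ s (_ , _ , f) = Admissible s f

  Different : Rel RationalFunction 0ℓ
  Different (_ , _ , f) (_ , _ , g) = ¬ f ≂ g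

  -- Distinctness follows from distance: equal permutations have distance 0, while `q ∸ 4` is
  -- positive.
  array : ∀ {s} → 4 < q → ∀ fs → All IsPRF′ fs → All (Admissible′ s) fs → AllPairs Different fs →
    PermutationArray (suc q) (q ∸ 4) (length fs)
  array {s} 4<q fs prf adm diff = record
    { π        = π
    ; distinct = λ i j i≢j π≈ → ℕ.<⇒≢ (ℕ.<-≤-trans (ℕ.m<n⇒0<n∸m 4<q) (distance i j i≢j)) (sym (hd≡0 (π i) (π j) π≈))
    ; distance = distance
    }
    where
    bij : ∀ i → Bijective _≡_ _≡_ (value F (proj₂ (proj₂ (lookup fs i))))
    bij i = IsPRF.permutes (All.lookup prf (∈-lookup i))
    π : Fin (length fs) → Permutation′ (suc q)
    π i = permutation (value F (proj₂ (proj₂ (lookup fs i)))) (bij i)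
    distance : ∀ i j → i ≢ j → q ∸ 4 ≤ hd (π i) (π j)
    distance i j i≢j = hd-fractions _ _ (All.lookup adm (∈-lookup i)) (All.lookup adm (∈-lookup j))
      (bij i) (bij j) (AllPairs-lookup (λ f≄g e → f≄g (sym ∘ e)) diff i j i≢j)
    hd≡0 : ∀ (π σ : Permutation′ (suc q)) → π Perm.≈ σ → hd π σ ≡ 0
    hd≡0 π σ π≈σ = cong length (List.filter-none (λ x → ¬? (π ⟨$⟩ʳ x Fin.≟ σ ⟨$⟩ʳ x))
      (All.universal (λ x ne → ne (π≈σ x)) (allFin (suc q))))

  -- `deduplicate` separates fractions only within one pair of degrees; this separates those of
  -- different pairs.
  different-degrees : ∀ {v u v′ u′} {f : Fraction F v u} {g : Fraction F v′ u′} →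
    IsPRF F f → IsPRF F g → (v , u) ≢ (v′ , u′) → ¬ f ≂ g
  different-degrees {f = f@(V , U)} {g@(V′ , U′)} pf pg ne e
    with reduced-degrees {num f} {den f} {num g} {den g}
      (last-degree F V (IsPRF.V-degree pf)) (last-degree F U (IsPRF.U-degree pf))
      (last-degree F V′ (IsPRF.V-degree pg)) (last-degree F U′ (IsPRF.U-degree pg))
      (IsPRF.coprime pf) (IsPRF.coprime pg) (coefficientwise e)
  ... | refl , refl = ne refl

  -- Numerator degree, denominator degree, and a list of fractions of these degrees.
  Block : Set
  Block = ∃₂ λ v u → List (Fraction F v u)

  degrees : Block → ℕ × ℕ
  degrees (v , u , _) = v , u

  members : Block → List RationalFunction
  members (v , u , fs) = List.map (λ f → v , u , f) fs

  record Valid (s : Carrier) (b : Block) : Set where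
    fs = proj₂ (proj₂ b)
    field
      prfs       : All (IsPRF F) fs
      admissible : All (Admissible s) fs
      different  : AllPairs (λ f g → ¬ f ≂ g) fs

  valid-members : ∀ {s b} → Valid s b →
    All IsPRF′ (members b) × All (Admissible′ s) (members b) × AllPairs Different (members b)
  valid-members val = All.map⁺ prfs , All.map⁺ admissible , AllPairs.map⁺ different
    where open Valid val

  blocks-different : ∀ {s} bs → All (Valid s) bs → Unique (List.map degrees bs) →
    AllPairs (λ b c → All (λ f → All (Different f) (members c)) (members b)) bs
  blocks-different []       []          []           = []
  blocks-different (b ∷ bs) (val ∷ vals) (b∉ ∷ bs!) =
    All.zipWith (λ {c} (d≢ , valc) →
      All.map⁺ (All.map (λ {f} pf → All.map⁺ (All.map (λ {g} pg → different-degrees {f = f} {g} pf pg d≢)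
        (Valid.prfs valc))) (Valid.prfs val)))
      (All.map⁻ b∉ , vals)
    ∷ blocks-different bs vals bs!

  union-array : ∀ {s} → 4 < q → ∀ bs → All (Valid s) bs → Unique (List.map degrees bs) →
    PermutationArray (suc q) (q ∸ 4) (length (concatMap members bs))
  union-array 4<q bs vals bs! = array 4<q (concatMap members bs)
    (All.concat⁺ (All.map⁺ (All.map (proj₁ ∘ valid-members) vals)))
    (All.concat⁺ (All.map⁺ (All.map (proj₁ ∘ proj₂ ∘ valid-members) vals)))
    (AllPairs.concat⁺ (All.map⁺ (All.map (proj₂ ∘ proj₂ ∘ valid-members) vals))
      (AllPairs.map⁺ (blocks-different bs vals bs!)))

  size : Block → ℕ
  size (_ , _ , fs) = length fs

  length-members : ∀ bs → length (concatMap members bs) ≡ sum (List.map size bs)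
  length-members bs = trans (length-concatMap members bs)
    (cong sum (List.map-cong (λ (_ , _ , fs) → List.length-map _ fs) bs))

  -- The blocks of the theorem and their total size.

  lowDegrees : List (ℕ × ℕ)
  lowDegrees = cartesianProduct (upTo 3) (upTo 3)

  low : All (λ (v , u) → v ≤ 2 × u ≤ 2) lowDegrees
  low = from-yes (All.all? (λ (v , u) → v ℕ.≤? 2 ×-dec u ℕ.≤? 2) lowDegrees)

  lowBlock : ℕ × ℕ → Block
  lowBlock (v , u) = v , u , PRFs F v u

  lowBlock-valid : ∀ {s v u} → v ≤ 2 × u ≤ 2 → Valid s (lowBlock (v , u))
  lowBlock-valid {v = v} {u} (v≤2 , u≤2) = record
    { prfs       = All.deduplicate⁺ (_≃?_ F) (All.all-filter (isPRF? F) (fractions F v u))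
    ; admissible = All.universal (λ _ → record { den≤2 = u≤2 ; num≤3 = inj₁ v≤2 }) _
    ; different  = deduplicate-AllPairs (_≃?_ F) _
    }

  -- Joins the nine low blocks to one cubic block; leaving `s` and `e` open lets it serve both terms
  -- of the maximum.
  T₃+cubic≤M : 4 < q → ∀ {s e} E → Valid s (3 , e , E) → T₃ F + length E ≤ M (suc q) (q ∸ 4)
  T₃+cubic≤M 4<q {s} {e} E val = subst (_≤ M (suc q) (q ∸ 4)) total
    (M-upper (union-array 4<q blocks (val ∷ All.map⁺ (All.map lowBlock-valid low)) blocks!))
    where
    blocks : List Block
    blocks = (3 , e , E) ∷ List.map lowBlock lowDegrees
    blocks! : Unique (List.map degrees blocks)
    -- The cubic block is separate because low numerators have degree at most 2.
    blocks! = All.map (λ { (v≤2 , _) refl → ℕ.<-irrefl refl v≤2 }) low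
            ∷ Unique.cartesianProduct⁺ (Unique.upTo⁺ 3) (Unique.upTo⁺ 3)
    -- `lowDegrees` runs through the pairs in the order of the nested sums of `T₃`; only bracketing,
    -- the zeros of empty sums and the place of the cubic block differ.
    regroup : ∀ x a b c d e f g h i → x + (a + (b + (c + (d + (e + (f + (g + (h + (i + 0)))))))))
      ≡ (a + (b + (c + 0))) + ((d + (e + (f + 0))) + ((g + (h + (i + 0))) + 0)) + x
    regroup = solve-∀
    total : length (concatMap members blocks) ≡ T₃ F + length E
    total = trans (length-members blocks)
      (regroup (length E) (N F 0 0) (N F 0 1) (N F 0 2) (N F 1 0) (N F 1 1) (N F 1 2) (N F 2 0) (N F 2 1) (N F 2 2))

  coeff-last : ∀ {n} (xs : Vec Carrier (suc n)) → coeff F (toList xs) n ≡ last xs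
  coeff-last (x ∷ [])     = refl
  coeff-last (x ∷ y ∷ xs) = coeff-last (y ∷ xs)

  monic-valid : Valid 1# (3 , 2 , monicPRFs F 3 2)
  monic-valid = record
    { prfs       = All.map proj₁ monic
    ; admissible = All.map (λ { {V , U} (_ , V≡1 , U≡1) → record
        { den≤2 = ℕ.≤-refl
        -- Both leading coefficients are 1, so they agree and `s` is 1.
        ; num≤3 = inj₂ (refl , trans (trans (coeff-last U) U≡1)
            (sym (trans (*-identityˡ _) (trans (coeff-last V) V≡1))))
        } }) monic
    ; different  = deduplicate-AllPairs (_≃?_ F) _
    }
    where
    monic : All (λ f → IsPRF F f × IsMonic F f) (monicPRFs F 3 2)
    monic = All.deduplicate⁺ (_≃?_ F)
      (All.all-filter (λ f → isPRF? F f ×-dec isMonic? F f) (fractions F 3 2))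

  polynomial-valid : Valid 0# (3 , 0 , PRFs F 3 0)
  polynomial-valid = record
    { prfs       = All.deduplicate⁺ (_≃?_ F) (All.all-filter (isPRF? F) (fractions F 3 0))
    ; admissible = All.universal (λ (V , U) → record
        -- A constant denominator has coefficient 0 at index 2, which is `0#` times the leading
        -- coefficient of the numerator.
        { den≤2 = z≤n ; num≤3 = inj₂ (refl , trans (coeff-beyond U 2 (s≤s z≤n)) (sym (zeroˡ _))) }) _
    ; different  = deduplicate-AllPairs (_≃?_ F) _
    }

theorem3p11 : (q : ℕ) → IsPrimePower q → q > 7 → (F : FiniteField q) →
    M (q + 1) (q ∸ 4) ≥ T₃ F + (Nᵐ F 3 2 ⊔ N F 3 0)
theorem3p11 q _ q>7 F = begin
  -- Addition distributes over the maximum, so each alternative is bounded by an array of its own.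
  T₃ F + (Nᵐ F 3 2 ⊔ N F 3 0)           ≡⟨ ℕ.+-distribˡ-⊔ (T₃ F) (Nᵐ F 3 2) (N F 3 0) ⟩
  (T₃ F + Nᵐ F 3 2) ⊔ (T₃ F + N F 3 0)  ≤⟨ ℕ.⊔-lub (T₃+cubic≤M 4<q (monicPRFs F 3 2) monic-valid)
                                                   (T₃+cubic≤M 4<q (PRFs F 3 0) polynomial-valid) ⟩
  M (suc q) (q ∸ 4)                     ≡⟨ cong (λ n → M n (q ∸ 4)) (ℕ.+-comm q 1) ⟨
  M (q + 1) (q ∸ 4)                     ∎
  where
  open ℕ.≤-Reasoning
  open Fractions F
  4<q : 4 < q
  4<q = ℕ.<-trans (s≤s (s≤s (s≤s (s≤s (s≤s z≤n))))) q>7
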